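{- Let $\mathcal{H}_0$ be the class of $2$-edge extremal minimal bipartite matching covered graphs and $\mathcal{H}_1$ the class of $2$-edge $n$-extremal minimal bipartite matching covered graphs. Then $\mathcal{H}_1\subset\mathcal{H}_0$ (a proper containment).
   Context: All graphs are finite and loopless; parallel edges are allowed. For a graph $G=(V,E)$ write $n=|V|$ and $m=|E|$. A connected graph on four or more vertices is matching covered if every edge lies in some perfect matching. A matching covered graph is minimal if deleting any single edge yields a graph that is not matching covered. $E_2$ is the set of edges both of whose ends have degree two. A minimal bipartite matching covered graph is $2$-edge extremal if $|E_2|=m-n+2$, and $2$-edge $n$-extremal if $|E_2|=\frac{n+10}{6}$. Classes are regarded up to isomorphism. -}

module Defs where

open import Data.Bool using (Bool)
open import Data.Fin using (Fin; punchIn; _≟_)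
open import Data.Fin.Subset using (Subset; _∈_)
open import Data.List using (length; filter; allFin)
open import Data.Nat as ℕ using (ℕ; suc; _+_; _*_; _≥_)
open import Data.Product using (_×_; _,_; Σ-syntax; ∃-syntax; ∃!; proj₁; proj₂)
open import Data.Sum using (_⊎_)
open import Data.Vec.Functional using (Vector; removeAt)
open import Function using (_↔_; Inverse)
open import Level using (0ℓ)
open import Relation.Binary.Construct.Closure.ReflexiveTransitive using (Star)
open import Relation.Binary.PropositionalEquality using (_≡_; _≢_)
open import Relation.Nullary using (¬_; _×-dec_; _⊎-dec_)
open import Relation.Unary using (Pred; Decidable)

-- Edges are named by Fin |E|, so parallel edges are allowed.  The order of
-- the two ends of an edge carries no meaning: every notion below is
-- symmetric in it.
record Graph : Set where
  field
    |V| |E|  : ℕ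
    ends     : Vector (Fin |V| × Fin |V|) |E|
    loopless : ∀ e → proj₁ (ends e) ≢ proj₂ (ends e)

module _ (G : Graph) where
  open Graph G

  Joins : Fin |E| → Fin |V| → Fin |V| → Set
  Joins e u v = ends e ≡ (u , v) ⊎ ends e ≡ (v , u)

  Incident : Fin |E| → Fin |V| → Set
  Incident e v = proj₁ (ends e) ≡ v ⊎ proj₂ (ends e) ≡ v

  incident? : ∀ v → Decidable (λ e → Incident e v)
  incident? v e = (proj₁ (ends e) ≟ v) ⊎-dec (proj₂ (ends e) ≟ v)

  -- Counting incident edges is the degree because there are no loops.
  degree : Fin |V| → ℕ
  degree v = length (filter (incident? v) (allFin |E|))

  Adjacent : Fin |V| → Fin |V| → Set
  Adjacent u v = ∃[ e ] Joins e u v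

  Connected : Set
  Connected = ∀ u v → Star Adjacent u v

  Bipartite : Set
  Bipartite = Σ[ side ∈ (Fin |V| → Bool) ] ∀ e → side (proj₁ (ends e)) ≢ side (proj₂ (ends e))

  PerfectMatching : Subset |E| → Set
  PerfectMatching M = ∀ v → ∃! _≡_ λ e → e ∈ M × Incident e v

  MatchingCovered : Set
  MatchingCovered =
    |V| ≥ 4 × Connected × (∀ e → ∃[ M ] PerfectMatching M × e ∈ M)

  E₂ : Pred (Fin |E|) 0ℓ
  E₂ e = degree (proj₁ (ends e)) ≡ 2 × degree (proj₂ (ends e)) ≡ 2

  E₂? : Decidable E₂
  E₂? e = (degree (proj₁ (ends e)) ℕ.≟ 2) ×-dec (degree (proj₂ (ends e)) ℕ.≟ 2)

  |E₂| : ℕ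
  |E₂| = length (filter E₂? (allFin |E|))

-- The vertex set is kept; only the edge e is removed.
delete : (G : Graph) → Fin (Graph.|E| G) → Graph
delete record { |V| = n ; |E| = suc m ; ends = ends ; loopless = loopless } e = record
  { |V|      = n
  ; |E|      = m
  ; ends     = removeAt ends e
  ; loopless = λ f → loopless (punchIn e f)
  }

Minimal : Pred Graph 0ℓ
Minimal G = ∀ e → ¬ MatchingCovered (delete G e)

MinimalBipartiteMatchingCovered : Pred Graph 0ℓ
MinimalBipartiteMatchingCovered G = Bipartite G × MatchingCovered G × Minimal G

-- |E₂| = m - n + 2, rearranged to avoid truncated subtraction.
TwoEdgeExtremal : Pred Graph 0ℓ
TwoEdgeExtremal G = |E₂| G + |V| ≡ |E| + 2
  where open Graph G

-- |E₂| = (n + 10) / 6, as an exact (not rounded) quotient.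
TwoEdgeNExtremal : Pred Graph 0ℓ
TwoEdgeNExtremal G = 6 * |E₂| G ≡ Graph.|V| G + 10

ℋ₀ : Pred Graph 0ℓ
ℋ₀ G = MinimalBipartiteMatchingCovered G × TwoEdgeExtremal G

ℋ₁ : Pred Graph 0ℓ
ℋ₁ G = MinimalBipartiteMatchingCovered G × TwoEdgeNExtremal G

record _≅_ (G H : Graph) : Set where
  private
    module G = Graph G
    module H = Graph H
  field
    vertices : Fin G.|V| ↔ Fin H.|V|
    edges    : Fin G.|E| ↔ Fin H.|E|
    joins    : ∀ {e u v} → Joins G e u v →
               Joins H (Inverse.to edges e) (Inverse.to vertices u) (Inverse.to vertices v)

infix 4 _≅_ _⊊_

-- Proper containment of classes of graphs regarded up to isomorphism: the
-- witness is not isomorphic to any member of the smaller class.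
_⊊_ : Pred Graph 0ℓ → Pred Graph 0ℓ → Set
P ⊊ Q = (∀ G → P G → Q G) × ∃[ G ] Q G × (∀ H → G ≅ H → ¬ P H)

{-# OPTIONS --safe #-}
-- Write n, m, k for the numbers of vertices, edges and E₂-edges of a minimal
-- bipartite matching covered graph G.
--
-- (1) k ≥ m − n + 2.  G has an ear decomposition starting from any given
-- edge, with m − n + 1 ears.  Each ear P contains an E₂-edge: when a later
-- ear R ends inside P, some subpath of P is a removable ear of the enlarged
-- graph, because R together with the rest of P gives a detour.  So P contains
-- a removable ear of G itself; by minimality it is not a single edge, and its
-- inner edges are in E₂.  Starting from an E₂-edge gives one more.
--
-- (2) k ≥ 6n − 5m, by counting degrees.
--
-- If 6k = n + 10, the combination 5·(1) + (2) is tight, hence so is (1).  The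
-- containment is strict because k = m − n + 2 for four internally disjoint
-- paths of length three with common ends, where n + 10 = 20 is not divisible
-- by 6.
module Submission where

open import Defs

import Algebra.Solver.CommutativeMonoid as CommutativeMonoidSolver
open import Data.Bool as Bool using (Bool; true; false)
open import Data.Fin as Fin using (Fin; #_; punchIn; punchOut)
open import Data.Fin.Patterns using (0F; 1F; 2F; 3F; 4F; 5F; 6F; 7F; 8F; 9F)
import Data.Fin.Properties as Finₚ
open import Data.Fin.Subset using (Subset) renaming (_∈_ to _∈ₛ_)
import Data.Fin.Subset.Properties as Subsetₚ
open import Data.List using (List; []; _∷_; _++_; [_]; length; map; concat; allFin; filter)
open import Data.List.Properties
  using (++-identityʳ; length-++; length-map; length-tabulate; filter-++; filter-accept; filter-reject; filter-none)
import Data.List.Membership.DecPropositional as DecMembership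
open import Data.List.Membership.Propositional using (_∈_; _∉_)
open import Data.List.Membership.Propositional.Properties
  using (∈-++⁺ˡ; ∈-++⁺ʳ; ∈-++⁻; ∈-∃++; ∈-map⁻; ∈-allFin; ∈-filter⁺; ∈-length)
open import Data.List.Relation.Binary.Permutation.Propositional
  using (_↭_; refl; prep; swap; ↭-refl; ↭-sym; ↭-trans; ↭-reflexive; ↭⇒↭ₛ; module PermutationReasoning)
open import Data.List.Relation.Binary.Permutation.Propositional.Properties
  using (∈-resp-↭; ++⁺; ++⁺ˡ; ++⁺ʳ; shift; shifts; ++-comm; ++-assoc; ↭-length; filter-↭; ++-commutativeMonoid)
import Data.List.Relation.Binary.Permutation.Setoid.Properties as SetoidPerm
open import Data.List.Relation.Binary.Subset.Propositional using (_⊆_)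
open import Data.List.Relation.Unary.All as All using (All; []; _∷_)
open import Data.List.Relation.Unary.AllPairs using ([]; _∷_)
open import Data.List.Relation.Unary.Any using (here; there)
open import Data.List.Relation.Unary.Unique.Propositional using (Unique)
import Data.List.Relation.Unary.Unique.Propositional.Properties as Uniqueₚ
open import Data.Nat as ℕ using (ℕ; zero; suc; _+_; _*_; _≤_; _<_; z≤n; s≤s)
open import Data.Nat.Divisibility using (_∣?_; divides)
import Data.Nat.Properties as ℕₚ
open import Data.Nat.Solver using (module +-*-Solver)
open import Data.Product using (_×_; _,_; Σ-syntax; ∃-syntax; ∃!; proj₁; proj₂)
open import Data.Sum using (_⊎_; inj₁; inj₂; [_,_]′)
import Data.Vec as Vec
import Data.Vec.Properties as Vecₚ
open import Function using (_∘_; id; Injection)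
open import Function.Properties.Inverse using (↔⇒↣; ↔-sym)
open import Relation.Binary.Construct.Closure.ReflexiveTransitive as Star using (Star; ε; _◅_; _◅◅_)
open import Relation.Binary.PropositionalEquality
  using (_≡_; _≢_; refl; sym; trans; cong; cong₂; subst; setoid; module ≡-Reasoning)
open import Relation.Nullary using (¬_; contradiction; yes; no; Dec; ¬?; _×-dec_; _→-dec_; does)
open import Relation.Nullary.Decidable using (decidable-stable; dec-true; from-yes; from-no)
open import Relation.Unary using (Pred; Decidable)

-- Lists and bags

-- A matching is a list `ms` of edges, and "`ms` covers exactly `W`" is the permutation
-- `verts ms ↭ W`; every exchange along a path then becomes an identity of bags, settled by a monoid
-- solver. A subgraph under construction carries the property `near`, not the coverage of its own
-- edges. Since `near` speaks of any two vertices on opposite sides, adjacent or not, it passes to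
-- the graph with an ear added, and at the end it matches the graph around an edge that lies outside
-- the base. New ears come from a fixed perfect matching `M`. The vertices built so far are always a
-- union of edges of `M`; a perfect matching through an edge leaving them, alternated with `M`,
-- leads out and back in. The delicate case is a new ear with both ends inside an old one. Ears are
-- directed from side `true` to side `false`, so the new ear may run against the old one; on the
-- bypassed stretch the two alternating classes of edges then change roles.

module Bag {A : Set} = CommutativeMonoidSolver (++-commutativeMonoid {A = A})
open Bag using (solve; _⊕_; _⊜_)
open +-*-Solver using (con; _:+_; _:*_; _:=_) renaming (solve to ℕ-solve)

Unique-resp-↭ : ∀ {A : Set} {xs ys : List A} → xs ↭ ys → Unique xs → Unique ys
Unique-resp-↭ {A} p = SetoidPerm.Unique-resp-↭ (setoid A) (↭⇒↭ₛ p)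

Unique-++⁻ : ∀ {A : Set} (xs : List A) {ys} → Unique (xs ++ ys) →
             Unique xs × Unique ys × (∀ {z} → z ∈ xs → z ∉ ys)
Unique-++⁻ []       u       = [] , u , λ ()
Unique-++⁻ (x ∷ xs) (a ∷ u) =
  let (ux , uy , disj) = Unique-++⁻ xs u in
  All.tabulate (λ z∈ → All.lookup a (∈-++⁺ˡ z∈)) ∷ ux , uy ,
  λ { (here refl) z∈ys → All.lookup a (∈-++⁺ʳ xs z∈ys) refl
    ; (there z∈)  z∈ys → disj z∈ z∈ys }

∈-tail : ∀ {A : Set} {x z : A} {xs} → z ∈ x ∷ xs → z ≢ x → z ∈ xs
∈-tail (here eq)  ne = contradiction eq ne
∈-tail (there z∈) _  = z∈

unique-⊆⇒↭ : ∀ {A : Set} {xs ys : List A} → Unique xs → xs ⊆ ys →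
             ∃[ zs ] ys ↭ xs ++ zs
unique-⊆⇒↭ {xs = []}     {ys} []      sub = ys , ↭-refl
unique-⊆⇒↭ {xs = x ∷ xs} {ys} (a ∷ u) sub
  with as , bs , refl ← ∈-∃++ (sub (here refl))
  with zs , p ← unique-⊆⇒↭ {ys = as ++ bs} u
         (λ z∈ → ∈-tail (∈-resp-↭ (shift x as bs) (sub (there z∈))) (λ eq → All.lookup a z∈ (sym eq)))
  = zs , ↭-trans (shift x as bs) (prep x p)

unique-⊆⇒length≤ : ∀ {A : Set} {xs ys : List A} → Unique xs → xs ⊆ ys → length xs ≤ length ys
unique-⊆⇒length≤ {xs = xs} u sub =
  let (zs , p) = unique-⊆⇒↭ u sub in
  subst (length xs ≤_) (sym (trans (↭-length p) (length-++ xs))) (ℕₚ.m≤m+n _ _)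

unique-⊆-≤⇒↭ : ∀ {A : Set} {xs ys : List A} → Unique xs → xs ⊆ ys → length ys ≤ length xs → ys ↭ xs
unique-⊆-≤⇒↭ {xs = xs} u sub le with unique-⊆⇒↭ u sub
... | []     , p = subst (_ ↭_) (++-identityʳ xs) p
... | z ∷ zs , p = contradiction (ℕₚ.≤-trans (ℕₚ.≤-reflexive (sym eq)) le) (ℕₚ.m+1+n≰m (length xs))
  where
  eq = trans (↭-length p) (length-++ xs)

unique-⊆⊇⇒↭ : ∀ {A : Set} {xs ys : List A} → Unique xs → Unique ys → xs ⊆ ys → ys ⊆ xs → xs ↭ ys
unique-⊆⊇⇒↭ ux uy s t = ↭-sym (unique-⊆-≤⇒↭ ux s (unique-⊆⇒length≤ uy t))

++-rotate : ∀ {A : Set} (xs ys zs : List A) → xs ++ (ys ++ zs) ↭ (xs ++ zs) ++ ys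
++-rotate = solve 3 (λ x y z → x ⊕ (y ⊕ z) ⊜ (x ⊕ z) ⊕ y) refl

-- Alternating paths in a bipartite graph

module Paths {V E : Set} (α β : E → V) (side : V → Bool)
             (side-α : ∀ e → side (α e) ≡ true) (side-β : ∀ e → side (β e) ≡ false) where

  α≢β : ∀ {e f} → α e ≢ β f
  α≢β {e} {f} eq with trans (sym (side-α e)) (trans (cong side eq) (side-β f))
  ... | ()

  verts : List E → List V
  verts []       = []
  verts (e ∷ es) = α e ∷ β e ∷ verts es

  verts-++ : ∀ es {fs} → verts (es ++ fs) ≡ verts es ++ verts fs
  verts-++ []       = refl
  verts-++ (e ∷ es) = cong (λ vs → α e ∷ β e ∷ vs) (verts-++ es)

  verts-↭ : ∀ {es fs} → es ↭ fs → verts es ↭ verts fs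
  verts-↭ refl         = refl
  verts-↭ (prep e p)   = prep _ (prep _ (verts-↭ p))
  verts-↭ (swap e f p) =
    ↭-trans (++⁺ˡ (verts (e ∷ [ f ])) (verts-↭ p)) (shifts (verts [ e ]) (verts [ f ]))
  verts-↭ (_↭_.trans p q)  = ↭-trans (verts-↭ p) (verts-↭ q)

  verts⁺ : ∀ {e es} → e ∈ es → α e ∈ verts es × β e ∈ verts es
  verts⁺ (here refl) = here refl , there (here refl)
  verts⁺ (there e∈)  = let (a , b) = verts⁺ e∈ in there (there a) , there (there b)

  verts⁻ : ∀ {v} es → v ∈ verts es → ∃[ e ] e ∈ es × (v ≡ α e ⊎ v ≡ β e)
  verts⁻ (e ∷ es) (here eq)         = e , here refl , inj₁ eq
  verts⁻ (e ∷ es) (there (here eq)) = e , here refl , inj₂ eq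
  verts⁻ (e ∷ es) (there (there v∈)) = let (f , f∈ , at) = verts⁻ es v∈ in f , there f∈ , at

  private variable a b c d x y z : V

  -- A path of odd length from an α-end to a β-end.
  data Path : V → V → Set where
    edge : ∀ e → β e ≡ b → Path (α e) b
    cons : ∀ e f → β e ≡ β f → Path (α f) b → Path (α e) b

  source-side : Path a b → side a ≡ true
  source-side (edge e _)     = side-α e
  source-side (cons e _ _ _) = side-α e

  target-side : Path a b → side b ≡ false
  target-side (edge e refl)  = side-β e
  target-side (cons _ _ _ p) = target-side p

  -- The edges traversed from α to β, and those traversed from β to α.
  es fs : Path a b → List E
  es (edge e _)     = [ e ]
  es (cons e f _ p) = e ∷ es p
  fs (edge e _)     = []
  fs (cons e f _ p) = f ∷ fs p

  -- Along a path, `es` matches all vertices and `fs` all but the two ends. A matching can therefore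
  -- pass an ear in two ways: `fs` leaves the ends to the base, `es` takes them over.
  verts-path : (p : Path a b) → verts (es p) ↭ a ∷ b ∷ verts (fs p)
  verts-path (edge e refl) = ↭-refl
  verts-path {b = b} (cons e f eq p) rewrite eq =
    ↭-trans (prep _ (prep _ (verts-path p)))
      (prep _ (solve 4 (λ x y z w → x ⊕ (y ⊕ (z ⊕ w)) ⊜ z ⊕ (y ⊕ (x ⊕ w))) refl
        [ β f ] [ α f ] [ b ] (verts (fs p))))

  join : ∀ f → Path a (β f) → Path (α f) b → Path a b
  join f (edge e eq)      q = cons e f eq q
  join f (cons e g eq p)  q = cons e g eq (join f p q)

  es-join : ∀ f (p : Path a (β f)) (q : Path (α f) b) → es (join f p q) ≡ es p ++ es q
  es-join f (edge e _)     q = refl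
  es-join f (cons e _ _ p) q = cong (e ∷_) (es-join f p q)

  fs-join : ∀ f (p : Path a (β f)) (q : Path (α f) b) → fs (join f p q) ≡ fs p ++ f ∷ fs q
  fs-join f (edge e _)     q = refl
  fs-join f (cons _ g _ p) q = cong (g ∷_) (fs-join f p q)

  -- Follow p, then q backwards, then r: the edges of q change role.
  zigzag : Path a y → Path x y → Path x b → Path a b
  zigzag p (edge f refl)   r = join f p r
  zigzag p (cons e f eq q) r = zigzag p q (cons f e (sym eq) r)

  es-zigzag : (p : Path a y) (q : Path x y) (r : Path x b) →
              es (zigzag p q r) ↭ es p ++ fs q ++ es r
  es-zigzag p (edge f refl)   r = ↭-reflexive (es-join f p r)
  es-zigzag p (cons e f eq q) r =
    ↭-trans (es-zigzag p q (cons f e (sym eq) r)) (++⁺ˡ (es p) (shift f (fs q) (es r)))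

  fs-zigzag : (p : Path a y) (q : Path x y) (r : Path x b) →
              fs (zigzag p q r) ↭ fs p ++ es q ++ fs r
  fs-zigzag p (edge f refl)   r = ↭-reflexive (fs-join f p r)
  fs-zigzag p (cons e f eq q) r =
    ↭-trans (fs-zigzag p q (cons f e (sym eq) r)) (++⁺ˡ (fs p) (shift e (es q) (fs r)))

  -- Indexed by the path, so that a case distinction replaces the path itself by a `join`.
  data Split (f : E) : Path a b → Set where
    split : (p : Path a (β f)) (q : Path (α f) b) → Split f (join f p q)

  split-at : ∀ {f} (p : Path a b) → f ∈ fs p → Split f p
  split-at (cons e f eq p) (here refl) = split (edge e eq) p
  split-at (cons e f eq p) (there g∈) with split-at p g∈
  ... | split q r = split (cons e f eq q) r

  -- Adding an ear r from c to d to H₀ + p leaves a part `rest` of p which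
  -- is still an ear, now of H₀ + wrap r.
  data Reroute (W₀ : List V) (p : Path a b) (c d : V) : Set where
    straight : ∀ {a′ b′ a″ b″} es₁ fs₁ (rest : Path a″ b″) →
      a′ ∈ W₀ → b′ ∈ W₀ → side a′ ≡ true → side b′ ≡ false →
      a″ ∈ verts fs₁ ++ W₀ → b″ ∈ verts fs₁ ++ W₀ →
      es p ↭ es₁ ++ es rest → fs p ↭ fs₁ ++ fs rest →
      -- Trading `fs₁` for `es₁` moves the uncovered pair from `a′`, `b′` to `c`, `d`; `near` for
      -- the extended graph rests on this balance.
      c ∷ d ∷ verts es₁ ↭ a′ ∷ b′ ∷ verts fs₁ →
      (∀ (r : Path c d) → Σ[ r′ ∈ Path a′ b′ ] (es r′ ↭ es₁ ++ es r) × (fs r′ ↭ fs₁ ++ fs r)) →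
      Reroute W₀ p c d
    reversed : ∀ es₁ fs₁ (rest : Path c d) →
      es p ↭ es₁ ++ fs rest → fs p ↭ fs₁ ++ es rest →
      (∀ (r : Path c d) → Σ[ r′ ∈ Path a b ] (es r′ ↭ es₁ ++ fs r) × (fs r′ ↭ fs₁ ++ es r)) →
      Reroute W₀ p c d

  interior-α : ∀ {W₀} {p : Path a b} → c ∈ verts (fs p) ++ W₀ → side c ≡ true →
               (∃[ f ] f ∈ fs p × c ≡ α f) ⊎ c ∈ W₀
  interior-α {p = p} c∈ sc with ∈-++⁻ (verts (fs p)) c∈
  ... | inj₂ c∈W₀ = inj₂ c∈W₀
  ... | inj₁ c∈fs with verts⁻ (fs p) c∈fs
  ... | f , f∈ , inj₁ eq   = inj₁ (f , f∈ , eq)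
  ... | f , _  , inj₂ refl = contradiction (trans (sym sc) (side-β f)) λ ()

  interior-β : ∀ {W₀} {p : Path a b} → d ∈ verts (fs p) ++ W₀ → side d ≡ false →
               (∃[ f ] f ∈ fs p × d ≡ β f) ⊎ d ∈ W₀
  interior-β {p = p} d∈ sd with ∈-++⁻ (verts (fs p)) d∈
  ... | inj₂ d∈W₀ = inj₂ d∈W₀
  ... | inj₁ d∈fs with verts⁻ (fs p) d∈fs
  ... | f , f∈ , inj₂ eq   = inj₁ (f , f∈ , eq)
  ... | f , _  , inj₁ refl = contradiction (trans (sym sd) (side-α f)) λ ()

  -- If `c` and `d` both lie inside `p`, their order along `p` decides. With `c` first, the stretch
  -- between them is bypassed in its own direction; with `d` first, the detour runs the new ear
  -- backwards, and `es` and `fs` change places. If `c` or `d` lies in `W₀`, the detour starts or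
  -- ends there, and the part of `p` that it skips is left over.
  reroute : ∀ {W₀} (p : Path a b) → a ∈ W₀ → b ∈ W₀ → side c ≡ true → side d ≡ false →
            (∃[ f ] f ∈ fs p × c ≡ α f) ⊎ c ∈ W₀ →
            (∃[ g ] g ∈ fs p × d ≡ β g) ⊎ d ∈ W₀ → Reroute W₀ p c d
  reroute p a∈ b∈ sc sd (inj₂ c∈) (inj₂ d∈) =
    straight [] [] p c∈ d∈ sc sd a∈ b∈ ↭-refl ↭-refl ↭-refl (λ r → r , ↭-refl , ↭-refl)
  reroute {a} {b} {d = d} p a∈ b∈ sc sd (inj₁ (f , f∈ , refl)) (inj₂ d∈) with split-at p f∈
  ... | split p₁ p₂ =
    straight (es p₁) (fs p₁ ++ [ f ]) p₂ a∈ d∈ (source-side p) sd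
      (∈-++⁺ˡ (proj₁ (verts⁺ {es = fs p₁ ++ [ f ]} (∈-++⁺ʳ (fs p₁) (here refl))))) (∈-++⁺ʳ _ b∈)
      (↭-reflexive (es-join f p₁ p₂))
      (↭-trans (↭-reflexive (fs-join f p₁ p₂)) (↭-sym (++-assoc (fs p₁) [ f ] (fs p₂))))
      (↭-trans (prep _ (prep _ (verts-path p₁)))
        (↭-trans (solve 5 (λ c d a y v → c ⊕ (d ⊕ (a ⊕ (y ⊕ v))) ⊜ a ⊕ (d ⊕ (v ⊕ (c ⊕ y)))) refl
            [ α f ] [ d ] [ a ] [ β f ] (verts (fs p₁)))
          (prep _ (prep _ (↭-reflexive (sym (verts-++ (fs p₁))))))))
      (λ r → join f p₁ r , ↭-reflexive (es-join f p₁ r) ,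
        ↭-trans (↭-reflexive (fs-join f p₁ r)) (↭-sym (++-assoc (fs p₁) [ f ] (fs r))))
  reroute {a} {b} {c = c} p a∈ b∈ sc sd (inj₂ c∈) (inj₁ (f , f∈ , refl)) with split-at p f∈
  ... | split p₁ p₂ =
    straight (es p₂) ([ f ] ++ fs p₂) p₁ c∈ b∈ sc (target-side p) (∈-++⁺ʳ _ a∈) (there (here refl))
      (↭-trans (↭-reflexive (es-join f p₁ p₂)) (++-comm (es p₁) (es p₂)))
      (↭-trans (↭-reflexive (fs-join f p₁ p₂)) (++-comm (fs p₁) (f ∷ fs p₂)))
      (prep _ (↭-trans (prep _ (verts-path p₂))
        (solve 4 (λ d x b v → d ⊕ (x ⊕ (b ⊕ v)) ⊜ b ⊕ (x ⊕ (d ⊕ v))) refl [ β f ] [ α f ] [ b ] (verts (fs p₂)))))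
      (λ r → join f r p₂ ,
        ↭-trans (↭-reflexive (es-join f r p₂)) (++-comm (es r) (es p₂)) ,
        ↭-trans (↭-reflexive (fs-join f r p₂)) (++-comm (fs r) (f ∷ fs p₂)))
  reroute {a} {b} p a∈ b∈ sc sd (inj₁ (f , f∈ , refl)) (inj₁ (g , g∈ , refl)) with split-at p f∈
  ... | split p₁ p₂ with ∈-++⁻ (fs p₁) (subst (g ∈_) (fs-join f p₁ p₂) g∈)
  -- `d` and `c` are the two ends of `f`, so the stretch left over is the single edge `f`.
  ... | inj₂ (here refl) =
    reversed (es p₁ ++ es p₂) (fs p₁ ++ fs p₂) (edge f refl)
      (↭-trans (↭-reflexive (es-join f p₁ p₂)) (solve 2 (λ x z → x ⊕ z ⊜ (x ⊕ z) ⊕ Bag.id) refl (es p₁) (es p₂)))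
      (↭-trans (↭-reflexive (fs-join f p₁ p₂)) (++-rotate (fs p₁) [ f ] (fs p₂)))
      (λ r → zigzag p₁ r p₂ ,
        ↭-trans (es-zigzag p₁ r p₂) (++-rotate (es p₁) (fs r) (es p₂)) ,
        ↭-trans (fs-zigzag p₁ r p₂) (++-rotate (fs p₁) (es r) (fs p₂)))
  reroute {a} {b} _ a∈ b∈ sc sd (inj₁ (f , f∈ , refl)) (inj₁ (g , g∈ , refl)) | split p₁ p₂ | inj₂ (there g∈₂)
    with split-at p₂ g∈₂
  ... | split q r =
    straight (es p₁ ++ es r) (fs p₁ ++ f ∷ g ∷ fs r) q a∈ b∈ (source-side p₁) (target-side r)
      (∈-++⁺ˡ (proj₁ (verts⁺ {es = fs p₁ ++ f ∷ g ∷ fs r} (∈-++⁺ʳ (fs p₁) (here refl)))))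
      (∈-++⁺ˡ (proj₂ (verts⁺ {es = fs p₁ ++ f ∷ g ∷ fs r} (∈-++⁺ʳ (fs p₁) (there (here refl))))))
      (es-wrap q) (fs-wrap q)
      (↭-trans (prep _ (prep _ (↭-trans (↭-reflexive (verts-++ (es p₁)))
                                         (++⁺ (verts-path p₁) (verts-path r)))))
        (↭-trans (solve 8 (λ x y a z v w b u → x ⊕ (y ⊕ ((a ⊕ (z ⊕ v)) ⊕ (w ⊕ (b ⊕ u))))
                                             ⊜ a ⊕ (b ⊕ (v ⊕ (x ⊕ (z ⊕ (w ⊕ (y ⊕ u))))))) refl
            [ α f ] [ β g ] [ a ] [ β f ] (verts (fs p₁)) [ α g ] [ b ] (verts (fs r)))
          (prep _ (prep _ (↭-reflexive (sym (verts-++ (fs p₁))))))))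
      (λ q′ → join f p₁ (join g q′ r) , es-wrap q′ , fs-wrap q′)
    where
    es-wrap : ∀ q → es (join f p₁ (join g q r)) ↭ (es p₁ ++ es r) ++ es q
    es-wrap q rewrite es-join f p₁ (join g q r) | es-join g q r =
      ++-rotate (es p₁) (es q) (es r)
    fs-wrap : ∀ q → fs (join f p₁ (join g q r)) ↭ (fs p₁ ++ f ∷ g ∷ fs r) ++ fs q
    fs-wrap q rewrite fs-join f p₁ (join g q r) | fs-join g q r =
      solve 5 (λ x f y g z → x ⊕ (f ⊕ (y ⊕ (g ⊕ z))) ⊜ (x ⊕ (f ⊕ (g ⊕ z))) ⊕ y) refl
        (fs p₁) [ f ] (fs q) [ g ] (fs r)
  reroute _ a∈ b∈ sc sd (inj₁ (f , f∈ , refl)) (inj₁ (g , g∈ , refl)) | split p₁ p₂ | inj₁ g∈₁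
    with split-at p₁ g∈₁
  -- Here `d` comes before `c`. Read from `c`, the stretch between them is `f`, then `r` backwards,
  -- then `g`.
  ... | split q r =
    reversed (es q ++ es p₂) (fs q ++ fs p₂) (zigzag (edge f refl) r (edge g refl))
      es-p fs-p
      (λ r → zigzag q r p₂ ,
        ↭-trans (es-zigzag q r p₂) (++-rotate (es q) (fs r) (es p₂)) ,
        ↭-trans (fs-zigzag q r p₂) (++-rotate (fs q) (es r) (fs p₂)))
    where
    es-p : es (join f (join g q r) p₂) ↭ (es q ++ es p₂) ++ fs (zigzag (edge f refl) r (edge g refl))
    es-p rewrite es-join f (join g q r) p₂ | es-join g q r =
      ↭-trans (solve 3 (λ x y z → (x ⊕ y) ⊕ z ⊜ (x ⊕ z) ⊕ (y ⊕ Bag.id)) refl (es q) (es r) (es p₂))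
        (++⁺ˡ (es q ++ es p₂) (↭-sym (fs-zigzag (edge f refl) r (edge g refl))))
    fs-p : fs (join f (join g q r) p₂) ↭ (fs q ++ fs p₂) ++ es (zigzag (edge f refl) r (edge g refl))
    fs-p rewrite fs-join f (join g q r) p₂ | fs-join g q r =
      ↭-trans (solve 5 (λ x g y f z → (x ⊕ (g ⊕ y)) ⊕ (f ⊕ z) ⊜ (x ⊕ z) ⊕ (f ⊕ (y ⊕ g))) refl
                (fs q) [ g ] (fs r) [ f ] (fs p₂))
        (++⁺ˡ (fs q ++ fs p₂) (↭-sym (es-zigzag (edge f refl) r (edge g refl))))

-- Elementary subgraphs and removable ears

module Ears {V E : Set} (α β : E → V) (side : V → Bool)
            (side-α : ∀ e → side (α e) ≡ true) (side-β : ∀ e → side (β e) ≡ false) where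
  open Paths α β side side-α side-β
  private variable a b c d : V

  edges : Path a b → List E
  edges p = es p ++ fs p

  length-es : (p : Path a b) → length (es p) ≡ suc (length (fs p))
  length-es (edge _ _)     = refl
  length-es (cons _ _ _ p) = cong suc (length-es p)

  length-verts : ∀ gs → length (verts gs) ≡ length gs + length gs
  length-verts []       = refl
  length-verts (g ∷ gs) = cong suc (trans (cong suc (length-verts gs)) (sym (ℕₚ.+-suc (length gs) (length gs))))

  Link : List E → V → V → Set
  Link F u v = ∃[ e ] e ∈ F × ((u ≡ α e × v ≡ β e) ⊎ (u ≡ β e × v ≡ α e))

  link-mono : ∀ {F F′ u v} → F ⊆ F′ → Star (Link F) u v → Star (Link F′) u v
  link-mono sub = Star.map λ { (e , e∈ , at) → e , sub e∈ , at }

  link-sym : ∀ {F u v} → Star (Link F) u v → Star (Link F) v u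
  link-sym = Star.reverse λ { (e , e∈ , inj₁ (p , q)) → e , e∈ , inj₂ (q , p)
                            ; (e , e∈ , inj₂ (p , q)) → e , e∈ , inj₁ (q , p) }

  edges-ends : (p : Path a b) → ∀ {e} → e ∈ edges p →
               α e ∈ a ∷ b ∷ verts (fs p) × β e ∈ a ∷ b ∷ verts (fs p)
  edges-ends p e∈ with ∈-++⁻ (es p) e∈
  ... | inj₁ e∈es = let (x , y) = verts⁺ e∈es in ∈-resp-↭ (verts-path p) x , ∈-resp-↭ (verts-path p) y
  ... | inj₂ e∈fs = let (x , y) = verts⁺ e∈fs in there (there x) , there (there y)

  path-linked : (p : Path a b) → ∀ {v} → v ∈ verts (fs p) → Star (Link (edges p)) a v
  path-linked (cons e f eq p) v∈ = go v∈
    where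
    F = edges (cons e f eq p)
    to-β : Star (Link F) (α e) (β f)
    to-β = (e , here refl , inj₁ (refl , sym eq)) ◅ ε
    to-α : Star (Link F) (α e) (α f)
    to-α = to-β ◅◅ (f , ∈-++⁺ʳ (es (cons e f eq p)) (here refl) , inj₂ (refl , refl)) ◅ ε
    sub : edges p ⊆ F
    sub = there ∘ [ ∈-++⁺ˡ , ∈-++⁺ʳ (es p) ∘ there ]′ ∘ ∈-++⁻ (es p)
    go : ∀ {v} → v ∈ verts (f ∷ fs p) → Star (Link F) (α e) v
    go (here refl)         = to-α
    go (there (here refl)) = to-β
    go (there (there v∈))  = to-α ◅◅ link-mono sub (path-linked p v∈)

  -- The subgraph with vertex list W and edge list F is matching covered
  -- (or a single edge), in the form: it stays perfectly matchable after
  -- removing any two vertices of opposite sides.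
  record Elementary (W : List V) (F : List E) : Set where
    field
      ends-in   : ∀ {e} → e ∈ F → α e ∈ W × β e ∈ W
      perfect   : ∃[ ms ] ms ⊆ F × verts ms ↭ W
      near      : ∀ {c d} → c ∈ W → d ∈ W → side c ≡ true → side d ≡ false →
                  ∃[ ms ] ms ⊆ F × c ∷ d ∷ verts ms ↭ W
      connected : ∀ {u v} → u ∈ W → v ∈ W → Star (Link F) u v

  open Elementary

  single-edge : ∀ e → Elementary (verts [ e ]) [ e ]
  single-edge e = record
    { ends-in   = λ { (here refl) → here refl , there (here refl) }
    ; perfect   = [ e ] , id , ↭-refl
    ; near      = λ c∈ d∈ sc sd → [] , (λ ()) , near′ c∈ d∈ sc sd
    ; connected = λ u∈ v∈ → link-sym (from-α u∈) ◅◅ from-α v∈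
    }
    where
    near′ : c ∈ verts [ e ] → d ∈ verts [ e ] → side c ≡ true → side d ≡ false → c ∷ d ∷ [] ↭ verts [ e ]
    near′ (here refl)         (there (here refl)) _  _  = ↭-refl
    near′ (there (here refl)) _                   sc _  = contradiction (trans (sym sc) (side-β e)) λ ()
    near′ _                   (here refl)         _  sd = contradiction (trans (sym sd) (side-α e)) λ ()
    from-α : ∀ {v} → v ∈ verts [ e ] → Star (Link [ e ]) (α e) v
    from-α (here refl)         = ε
    from-α (there (here refl)) = (e , here refl , inj₁ (refl , refl)) ◅ ε

  -- For a pair `c`, `d` to be left out, `reroute` tells which matching of the base to extend. In
  -- the case `straight` it is one missing `a′` and `b′`. In the case `reversed` it is a perfect
  -- one, because the stretch between `d` and `c` can be matched without its ends by edges of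
  -- `es p`.
  add-ear : ∀ {W F} → Elementary W F → (p : Path a b) → a ∈ W → b ∈ W →
            Elementary (verts (fs p) ++ W) (edges p ++ F)
  add-ear {a} {b} {W} {F} H p a∈ b∈ = record
    { ends-in   = ends-in′
    ; perfect   = let (ms , sub , pm) = perfect H in
        fs p ++ ms , [ fs-in , old ∘ sub ]′ ∘ ∈-++⁻ (fs p) ,
        ↭-trans (↭-reflexive (verts-++ (fs p))) (++⁺ˡ (verts (fs p)) pm)
    ; near      = λ c∈ d∈ sc sd →
        near′ (reroute p a∈ b∈ sc sd (interior-α {p = p} c∈ sc) (interior-β {p = p} d∈ sd))
    ; connected = λ u∈ v∈ → link-sym (from-a u∈) ◅◅ from-a v∈
    }
    where
    old : ∀ {e} → e ∈ F → e ∈ edges p ++ F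
    old = ∈-++⁺ʳ (edges p)
    es-in : ∀ {e} → e ∈ es p → e ∈ edges p ++ F
    es-in = ∈-++⁺ˡ ∘ ∈-++⁺ˡ
    fs-in : ∀ {e} → e ∈ fs p → e ∈ edges p ++ F
    fs-in = ∈-++⁺ˡ ∘ ∈-++⁺ʳ (es p)

    path-end : ∀ {v} → v ∈ a ∷ b ∷ verts (fs p) → v ∈ verts (fs p) ++ W
    path-end (here refl)         = ∈-++⁺ʳ _ a∈
    path-end (there (here refl)) = ∈-++⁺ʳ _ b∈
    path-end (there (there v∈))  = ∈-++⁺ˡ v∈

    ends-in′ : ∀ {e} → e ∈ edges p ++ F → α e ∈ verts (fs p) ++ W × β e ∈ verts (fs p) ++ W
    ends-in′ e∈ with ∈-++⁻ (edges p) e∈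
    ... | inj₂ e∈F = let (p , q) = ends-in H e∈F in ∈-++⁺ʳ _ p , ∈-++⁺ʳ _ q
    ... | inj₁ e∈p = let (x , y) = edges-ends p e∈p in path-end x , path-end y

    from-a : ∀ {v} → v ∈ verts (fs p) ++ W → Star (Link (edges p ++ F)) a v
    from-a v∈ with ∈-++⁻ (verts (fs p)) v∈
    ... | inj₁ v∈p = link-mono ∈-++⁺ˡ (path-linked p v∈p)
    ... | inj₂ v∈W = link-mono old (connected H a∈ v∈W)

    open PermutationReasoning

    near′ : Reroute W p c d → ∃[ ms ] ms ⊆ edges p ++ F × c ∷ d ∷ verts ms ↭ verts (fs p) ++ W
    near′ {c} {d} (straight {a′} {b′} es₁ fs₁ rest a′∈ b′∈ sa sb _ _ es↭ fs↭ bal _)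
      with ms , sub , pm ← near H a′∈ b′∈ sa sb =
      ms ++ es₁ ++ fs rest ,
      [ old ∘ sub , [ es-in ∘ ∈-resp-↭ (↭-sym es↭) ∘ ∈-++⁺ˡ
                    , fs-in ∘ ∈-resp-↭ (↭-sym fs↭) ∘ ∈-++⁺ʳ fs₁ ]′ ∘ ∈-++⁻ es₁ ]′ ∘ ∈-++⁻ ms ,
      (begin
        c ∷ d ∷ verts (ms ++ es₁ ++ fs rest)
          ≡⟨ cong (λ l → c ∷ d ∷ l) (trans (verts-++ ms) (cong (verts ms ++_) (verts-++ es₁))) ⟩
        c ∷ d ∷ verts ms ++ verts es₁ ++ verts (fs rest)
          ↭⟨ solve 5 (λ c d m e r → c ⊕ (d ⊕ (m ⊕ (e ⊕ r))) ⊜ (c ⊕ (d ⊕ e)) ⊕ (m ⊕ r)) refl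
               [ c ] [ d ] (verts ms) (verts es₁) (verts (fs rest)) ⟩
        (c ∷ d ∷ verts es₁) ++ verts ms ++ verts (fs rest)
          ↭⟨ ++⁺ʳ _ bal ⟩
        (a′ ∷ b′ ∷ verts fs₁) ++ verts ms ++ verts (fs rest)
          ↭⟨ solve 5 (λ c d m e r → (c ⊕ (d ⊕ e)) ⊕ (m ⊕ r) ⊜ (e ⊕ r) ⊕ (c ⊕ (d ⊕ m))) refl
               [ a′ ] [ b′ ] (verts ms) (verts fs₁) (verts (fs rest)) ⟩
        (verts fs₁ ++ verts (fs rest)) ++ a′ ∷ b′ ∷ verts ms
          ↭⟨ ++⁺ (↭-trans (↭-reflexive (sym (verts-++ fs₁))) (verts-↭ (↭-sym fs↭))) pm ⟩
        verts (fs p) ++ W ∎)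
    near′ {c} {d} (reversed es₁ fs₁ rest es↭ fs↭ _)
      with ms , sub , pm ← perfect H =
      ms ++ fs₁ ++ fs rest ,
      [ old ∘ sub , [ fs-in ∘ ∈-resp-↭ (↭-sym fs↭) ∘ ∈-++⁺ˡ
                    , es-in ∘ ∈-resp-↭ (↭-sym es↭) ∘ ∈-++⁺ʳ es₁ ]′ ∘ ∈-++⁻ fs₁ ]′ ∘ ∈-++⁻ ms ,
      (begin
        c ∷ d ∷ verts (ms ++ fs₁ ++ fs rest)
          ≡⟨ cong (λ l → c ∷ d ∷ l) (trans (verts-++ ms) (cong (verts ms ++_) (verts-++ fs₁))) ⟩
        c ∷ d ∷ verts ms ++ verts fs₁ ++ verts (fs rest)
          ↭⟨ solve 5 (λ c d m e r → c ⊕ (d ⊕ (m ⊕ (e ⊕ r))) ⊜ (e ⊕ (c ⊕ (d ⊕ r))) ⊕ m) refl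
               [ c ] [ d ] (verts ms) (verts fs₁) (verts (fs rest)) ⟩
        (verts fs₁ ++ c ∷ d ∷ verts (fs rest)) ++ verts ms
          ↭⟨ ++⁺ (++⁺ˡ (verts fs₁) (↭-sym (verts-path rest))) pm ⟩
        (verts fs₁ ++ verts (es rest)) ++ W
          ↭⟨ ++⁺ʳ W (↭-trans (↭-reflexive (sym (verts-++ fs₁))) (verts-↭ (↭-sym fs↭))) ⟩
        verts (fs p) ++ W ∎)

  -- `X` is the ear as it was attached. Later ears may shorten the removable ear, but it never
  -- leaves `X`. As distinct ears share no edge, the edges of `E₂` found in them are distinct.
  record RemovableEar (W : List V) (F : List E) (X : List E) : Set where
    field
      {W₀}   : List V
      {F₀}   : List E
      base   : Elementary W₀ F₀
      {s t}  : V
      ear    : Path s t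
      s∈     : s ∈ W₀
      t∈     : t ∈ W₀
      W↭     : W ↭ verts (fs ear) ++ W₀
      F↭     : F ↭ edges ear ++ F₀
      ear⊆   : edges ear ⊆ X

  removable-new : ∀ {W F} → Elementary W F → (r : Path c d) → c ∈ W → d ∈ W →
                  RemovableEar (verts (fs r) ++ W) (edges r ++ F) (edges r)
  removable-new H r c∈ d∈ = record
    { base = H ; ear = r ; s∈ = c∈ ; t∈ = d∈ ; W↭ = ↭-refl ; F↭ = ↭-refl ; ear⊆ = id }

  -- The two ears change their order: the base first takes the detour through `r`, and what the
  -- detour skips of the old ear is attached last. Both orders use the same vertices and edges,
  -- whence the bag identities.
  removable-extend : ∀ {W F X} → RemovableEar W F X → (r : Path c d) → c ∈ W → d ∈ W →
                     RemovableEar (verts (fs r) ++ W) (edges r ++ F) X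
  removable-extend {c} {d} {W} {F} {X} R r c∈ d∈ =
    go (reroute ear s∈ t∈ sc sd (interior-α {p = ear} (∈-resp-↭ W↭ c∈) sc) (interior-β {p = ear} (∈-resp-↭ W↭ d∈) sd))
    where
    open RemovableEar R
    open PermutationReasoning
    sc = source-side r
    sd = target-side r
    go : Reroute W₀ ear c d → RemovableEar (verts (fs r) ++ W) (edges r ++ F) X
    go (straight es₁ fs₁ rest a′∈ b′∈ _ _ a″∈ b″∈ es↭ fs↭ _ wrap)
      with r′ , es′↭ , fs′↭ ← wrap r = record
      { base = add-ear base r′ a′∈ b′∈
      ; ear  = rest
      ; s∈   = in-new a″∈
      ; t∈   = in-new b″∈
      ; W↭   = begin
          verts (fs r) ++ W                                    ↭⟨ ++⁺ˡ (verts (fs r)) W↭ ⟩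
          verts (fs r) ++ verts (fs ear) ++ W₀                 ↭⟨ ++⁺ˡ (verts (fs r)) (++⁺ʳ W₀ (split-verts fs↭)) ⟩
          verts (fs r) ++ (verts fs₁ ++ verts (fs rest)) ++ W₀
            ↭⟨ solve 4 (λ a b c d → a ⊕ ((b ⊕ c) ⊕ d) ⊜ c ⊕ ((b ⊕ a) ⊕ d)) refl
                 (verts (fs r)) (verts fs₁) (verts (fs rest)) W₀ ⟩
          verts (fs rest) ++ (verts fs₁ ++ verts (fs r)) ++ W₀ ↭⟨ ++⁺ˡ (verts (fs rest)) (++⁺ʳ W₀ (split-verts fs′↭)) ⟨
          verts (fs rest) ++ verts (fs r′) ++ W₀               ∎
      ; F↭   = begin
          edges r ++ F                   ↭⟨ ++⁺ˡ (edges r) (↭-trans F↭ (++⁺ʳ F₀ (++⁺ es↭ fs↭))) ⟩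
          edges r ++ ((es₁ ++ es rest) ++ (fs₁ ++ fs rest)) ++ F₀
            ↭⟨ solve 7 (λ er fr e₁ e f₁ f z → (er ⊕ fr) ⊕ (((e₁ ⊕ e) ⊕ (f₁ ⊕ f)) ⊕ z)
                                       ⊜ (e ⊕ f) ⊕ (((e₁ ⊕ er) ⊕ (f₁ ⊕ fr)) ⊕ z)) refl
                 (es r) (fs r) es₁ (es rest) fs₁ (fs rest) F₀ ⟩
          edges rest ++ ((es₁ ++ es r) ++ (fs₁ ++ fs r)) ++ F₀
            ↭⟨ ++⁺ˡ (edges rest) (++⁺ʳ F₀ (++⁺ es′↭ fs′↭)) ⟨
          edges rest ++ edges r′ ++ F₀ ∎
      ; ear⊆ = ear⊆ ∘ [ ∈-++⁺ˡ ∘ ∈-resp-↭ (↭-sym es↭) ∘ ∈-++⁺ʳ es₁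
                      , ∈-++⁺ʳ (es ear) ∘ ∈-resp-↭ (↭-sym fs↭) ∘ ∈-++⁺ʳ fs₁ ]′ ∘ ∈-++⁻ (es rest)
      }
      where
      split-verts : ∀ {gs ks} → gs ↭ fs₁ ++ ks → verts gs ↭ verts fs₁ ++ verts ks
      split-verts p = ↭-trans (verts-↭ p) (↭-reflexive (verts-++ fs₁))
      in-new : ∀ {v} → v ∈ verts fs₁ ++ W₀ → v ∈ verts (fs r′) ++ W₀
      in-new v∈ = [ ∈-++⁺ˡ ∘ ∈-resp-↭ (↭-sym (split-verts fs′↭)) ∘ ∈-++⁺ˡ , ∈-++⁺ʳ _ ]′ (∈-++⁻ (verts fs₁) v∈)
    go (reversed es₁ fs₁ rest es↭ fs↭ wrap)
      with r′ , es′↭ , fs′↭ ← wrap r = record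
      { base = add-ear base r′ s∈ t∈
      ; ear  = rest
      ; s∈   = ∈-++⁺ˡ (∈-resp-↭ (↭-sym (split-verts r fs′↭)) (∈-++⁺ʳ (verts fs₁) (here refl)))
      ; t∈   = ∈-++⁺ˡ (∈-resp-↭ (↭-sym (split-verts r fs′↭)) (∈-++⁺ʳ (verts fs₁) (there (here refl))))
      ; W↭   = begin
          verts (fs r) ++ W                                    ↭⟨ ++⁺ˡ (verts (fs r)) W↭ ⟩
          verts (fs r) ++ verts (fs ear) ++ W₀                 ↭⟨ ++⁺ˡ (verts (fs r)) (++⁺ʳ W₀ (split-verts rest fs↭)) ⟩
          verts (fs r) ++ (verts fs₁ ++ c ∷ d ∷ verts (fs rest)) ++ W₀
            ↭⟨ solve 6 (λ a b c d e f → a ⊕ ((b ⊕ (c ⊕ (d ⊕ e))) ⊕ f) ⊜ e ⊕ ((b ⊕ (c ⊕ (d ⊕ a))) ⊕ f)) refl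
                 (verts (fs r)) (verts fs₁) [ c ] [ d ] (verts (fs rest)) W₀ ⟩
          verts (fs rest) ++ (verts fs₁ ++ c ∷ d ∷ verts (fs r)) ++ W₀ ↭⟨ ++⁺ˡ (verts (fs rest)) (++⁺ʳ W₀ (split-verts r fs′↭)) ⟨
          verts (fs rest) ++ verts (fs r′) ++ W₀               ∎
      ; F↭   = begin
          edges r ++ F                   ↭⟨ ++⁺ˡ (edges r) (↭-trans F↭ (++⁺ʳ F₀ (++⁺ es↭ fs↭))) ⟩
          edges r ++ ((es₁ ++ fs rest) ++ (fs₁ ++ es rest)) ++ F₀
            ↭⟨ solve 7 (λ er fr e₁ e f₁ f z → (er ⊕ fr) ⊕ (((e₁ ⊕ f) ⊕ (f₁ ⊕ e)) ⊕ z)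
                                       ⊜ (e ⊕ f) ⊕ (((e₁ ⊕ fr) ⊕ (f₁ ⊕ er)) ⊕ z)) refl
                 (es r) (fs r) es₁ (es rest) fs₁ (fs rest) F₀ ⟩
          edges rest ++ ((es₁ ++ fs r) ++ (fs₁ ++ es r)) ++ F₀
            ↭⟨ ++⁺ˡ (edges rest) (++⁺ʳ F₀ (++⁺ es′↭ fs′↭)) ⟨
          edges rest ++ edges r′ ++ F₀ ∎
      ; ear⊆ = ear⊆ ∘ [ ∈-++⁺ʳ (es ear) ∘ ∈-resp-↭ (↭-sym fs↭) ∘ ∈-++⁺ʳ fs₁
                      , ∈-++⁺ˡ ∘ ∈-resp-↭ (↭-sym es↭) ∘ ∈-++⁺ʳ es₁ ]′ ∘ ∈-++⁻ (es rest)
      }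
      where
      split-verts : ∀ {gs} (q : Path c d) → gs ↭ fs₁ ++ es q → verts gs ↭ verts fs₁ ++ c ∷ d ∷ verts (fs q)
      split-verts q p =
        ↭-trans (verts-↭ p) (↭-trans (↭-reflexive (verts-++ fs₁)) (++⁺ˡ (verts fs₁) (verts-path q)))

-- Ear decompositions

star-exit : ∀ {A : Set} {R : A → A → Set} {P : A → Set} → (∀ x → Dec (P x)) →
            ∀ {u v} → Star R u v → P u → ¬ P v → ∃[ x ] ∃[ y ] R x y × P x × ¬ P y
star-exit P? ε                  pu ¬pv = contradiction pu ¬pv
star-exit P? (_◅_ {j = w} r rs) pu ¬pv with P? w
... | yes pw = star-exit P? rs pw ¬pv
... | no ¬pw = _ , w , r , pu , ¬pw

unique-length≤ : ∀ {n} {xs : List (Fin n)} → Unique xs → length xs ≤ n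
unique-length≤ {n} {xs} u =
  subst (length xs ≤_) (length-tabulate id) (unique-⊆⇒length≤ u (λ {x} _ → ∈-allFin x))

module Search {n m : ℕ} (α β : Fin m → Fin n) (side : Fin n → Bool)
              (side-α : ∀ e → side (α e) ≡ true) (side-β : ∀ e → side (β e) ≡ false) where
  open Paths α β side side-α side-β
  open Ears α β side side-α side-β
  open DecMembership (Fin._≟_ {n}) using () renaming (_∈?_ to _∈V?_)
  open DecMembership (Fin._≟_ {m}) using () renaming (_∈?_ to _∈E?_)

  -- A perfect matching, given by the edge covering each vertex.
  record Mates : Set where
    field
      mate   : Fin n → Fin m
      at     : ∀ v → v ≡ α (mate v) ⊎ v ≡ β (mate v)
      mate-α : ∀ v → mate (α (mate v)) ≡ mate v
      mate-β : ∀ v → mate (β (mate v)) ≡ mate v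

    at-α : ∀ {v} → side v ≡ true → v ≡ α (mate v)
    at-α {v} sv with at v
    ... | inj₁ eq = eq
    ... | inj₂ eq = contradiction (trans (sym sv) (trans (cong side eq) (side-β _))) λ ()

    at-β : ∀ {v} → side v ≡ false → v ≡ β (mate v)
    at-β {v} sv with at v
    ... | inj₁ eq = contradiction (trans (sym sv) (trans (cong side eq) (side-α _))) λ ()
    ... | inj₂ eq = eq

    mate-at : ∀ {e v} → mate (α e) ≡ e → v ≡ α e ⊎ v ≡ β e → mate v ≡ e
    mate-at eq (inj₁ refl) = eq
    mate-at {e} eq (inj₂ refl) =
      trans (cong (mate ∘ β) (sym eq)) (trans (mate-β (α e)) eq)

  Through : Set
  Through = ∀ e → Σ[ N ∈ Mates ] Mates.mate N (α e) ≡ e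

  module _ (M : Mates) where
    open Mates M renaming (mate to μ) using ()
    private module M = Mates M

    -- `W` is a union of edges of `M`, so `M` also matches its complement and an alternating walk
    -- outside `W` never gets stuck.
    Closed : List (Fin n) → Set
    Closed W = ∀ {v} → v ∈ W → α (μ v) ∈ W × β (μ v) ∈ W

    -- `matched` preserves `Closed` when the ear is added; `leaves` keeps the `es` edges apart from
    -- the old edges, whose ends all lie in `W`.
    record OuterEar (W : List (Fin n)) : Set where
      field
        {c d}   : Fin n
        ear     : Path c d
        c∈      : c ∈ W
        d∈      : d ∈ W
        unique  : Unique (verts (fs ear))
        outside : ∀ {v} → v ∈ verts (fs ear) → v ∉ W
        matched : ∀ {f} → f ∈ fs ear → μ (α f) ≡ f
        leaves  : ∀ {e} → e ∈ es ear → α e ∉ W ⊎ β e ∉ W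

    module Walk (N : Mates) {W : List (Fin n)} (closed : Closed W) where
      open Mates N renaming (mate to ν) using ()
      private module N = Mates N

      from : ∀ {a} e → α e ≡ a → Path a (β e)
      from e refl = edge e refl

      es-from : ∀ {a} e (eq : α e ≡ a) → es (from e eq) ≡ [ e ]
      es-from e refl = refl

      fs-from : ∀ {a} e (eq : α e ≡ a) → fs (from e eq) ≡ []
      fs-from e refl = refl

      record Partial {c b} (p : Path c b) : Set where
        field
          c∈      : c ∈ W
          b∉      : b ∉ W
          b-new   : b ∉ verts (fs p)
          unique  : Unique (verts (fs p))
          outside : ∀ {v} → v ∈ verts (fs p) → v ∉ W
          fs⊆M    : ∀ {f} → f ∈ fs p → μ (α f) ≡ f
          es⊆N    : ∀ {e} → e ∈ es p → ν (α e) ≡ e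
          leaves  : ∀ {e} → e ∈ es p → α e ∉ W ⊎ β e ∉ W

      -- The walk leaves `W` along `N`, then alternates between `M` and `N`. No vertex recurs, as
      -- the matching edge by which it is reached would recur with it, so the walk must re-enter
      -- `W`. The number `k` is fuel, which cannot run out because there are at most `n` distinct
      -- inner vertices.
      walk : ∀ k {c b} (p : Path c b) → Partial p → n < k + length (verts (fs p)) → OuterEar W
      step : ∀ k {c b} f → b ≡ β f → μ b ≡ f → (p : Path c b) → Partial p →
             n < suc k + length (verts (fs p)) → OuterEar W

      walk zero    p P n< = contradiction (unique-length≤ (Partial.unique P)) (ℕₚ.<⇒≱ n<)
      walk (suc k) {b = b} p P n< =
        step k (μ b) (M.at-β (target-side p)) refl p P n<

      step k {c} f refl μb p P n< = finish (β e ∈V? W)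
        where
        open Partial P
        e = ν (α f)
        αe : α e ≡ α f
        αe = sym (N.at-α (side-α f))
        p′ = join f p (from e αe)
        μα : μ (α f) ≡ f
        μα = trans (cong (μ ∘ α) (sym μb)) (trans (M.mate-α (β f)) μb)
        fs↭ : fs p′ ↭ f ∷ fs p
        fs↭ rewrite fs-join f p (from e αe) | fs-from e αe = ++-comm (fs p) [ f ]
        es↭ : es p′ ↭ e ∷ es p
        es↭ rewrite es-join f p (from e αe) | es-from e αe = ++-comm (es p) [ e ]
        α∉ : α f ∉ W
        α∉ a∈ = b∉ (subst (λ g → β g ∈ W) μα (proj₂ (closed a∈)))
        α-new : α f ∉ verts (fs p)
        α-new a∈ with verts⁻ (fs p) a∈
        ... | g , g∈ , at = b-new (subst (λ h → β h ∈ verts (fs p))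
                                    (trans (sym (M.mate-at (fs⊆M g∈) at)) μα) (proj₂ (verts⁺ g∈)))
        unique′ : Unique (verts (fs p′))
        unique′ = Unique-resp-↭ (verts-↭ (↭-sym fs↭))
          (All.tabulate (λ { (here refl) eq → α≢β eq ; (there v∈) refl → α-new v∈ })
           ∷ All.tabulate (λ { v∈ refl → b-new v∈ }) ∷ unique)
        outside′ : ∀ {v} → v ∈ verts (fs p′) → v ∉ W
        outside′ v∈ with ∈-resp-↭ (verts-↭ fs↭) v∈
        ... | here refl         = α∉
        ... | there (here refl) = b∉
        ... | there (there v∈′) = outside v∈′
        matched′ : ∀ {g} → g ∈ fs p′ → μ (α g) ≡ g
        matched′ g∈ with ∈-resp-↭ fs↭ g∈
        ... | here refl = μα
        ... | there g∈′ = fs⊆M g∈′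
        es⊆N′ : ∀ {g} → g ∈ es p′ → ν (α g) ≡ g
        es⊆N′ g∈ with ∈-resp-↭ es↭ g∈
        ... | here refl = N.mate-α (α f)
        ... | there g∈′ = es⊆N g∈′
        leaves′ : ∀ {g} → g ∈ es p′ → α g ∉ W ⊎ β g ∉ W
        leaves′ g∈ with ∈-resp-↭ es↭ g∈
        ... | here refl = inj₁ (subst (_∉ W) (sym αe) α∉)
        ... | there g∈′ = leaves g∈′
        -- If the walk met β e before, it entered it along e, from α f.
        βe-old : β e ∉ β f ∷ verts (fs p)
        βe-old v∈ with verts⁻ (es p) (∈-resp-↭ (↭-sym (verts-path p)) (there v∈))
        ... | g , g∈ , at with trans (sym (N.mate-at (es⊆N g∈) at)) (N.mate-β (α f))
        ... | refl with ∈-resp-↭ (verts-path p) (subst (_∈ verts (es p)) αe (proj₁ (verts⁺ g∈)))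
        ... | here refl          = α∉ c∈
        ... | there (here eq)    = α≢β eq
        ... | there (there a∈)   = α-new a∈
        b-new′ : β e ∉ verts (fs p′)
        b-new′ v∈ with ∈-resp-↭ (verts-↭ fs↭) v∈
        ... | here eq   = α≢β (sym eq)
        ... | there v∈′ = βe-old v∈′
        n<′ : n < k + length (verts (fs p′))
        n<′ = ℕₚ.≤-trans n< (ℕₚ.≤-trans (ℕₚ.≤-reflexive (sym (ℕₚ.+-suc k _)))
          (ℕₚ.+-monoʳ-≤ k (subst (suc (length (verts (fs p))) ≤_) (sym (↭-length (verts-↭ fs↭))) (ℕₚ.n≤1+n _))))
        finish : Dec (β e ∈ W) → OuterEar W
        finish (yes d∈) = record
          { ear = p′ ; c∈ = c∈ ; d∈ = d∈ ; unique = unique′ ; outside = outside′ ; matched = matched′ ; leaves = leaves′ }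
        finish (no d∉) = walk k p′ (record
          { c∈ = c∈ ; b∉ = d∉ ; b-new = b-new′ ; unique = unique′ ; outside = outside′
          ; fs⊆M = matched′ ; es⊆N = es⊆N′ ; leaves = leaves′ }) n<′

      outer-ear : ∀ {e} → ν (α e) ≡ e → α e ∈ W → β e ∉ W → OuterEar W
      outer-ear {e} νe a∈ b∉ = walk (suc n) (edge e refl) (record
        { c∈ = a∈ ; b∉ = b∉ ; b-new = λ () ; unique = [] ; outside = λ ()
        ; fs⊆M = λ () ; es⊆N = λ { (here refl) → νe } ; leaves = λ { (here refl) → inj₂ b∉ } }) (s≤s (ℕₚ.m≤m+n n 0))

    module _ (N : Mates) {W : List (Fin n)} (closed : Closed W) (uW : Unique W) where
      open Mates N renaming (mate to ν) using ()
      private module N = Mates N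

      -- If no edge leaves W from its α-end, then alternating along ν and μ
      -- maps W injectively into W, hence onto W, so no edge of ν enters W.
      no-exit⇒no-entry : (∀ e → α e ∈ W → β e ∈ W) → ∀ {e} → ν (α e) ≡ e → β e ∈ W → α e ∈ W
      no-exit⇒no-entry no-exit {e} νe b∈ =
        let (v , v∈ , eq) = ∈-map⁻ (λ v → next v (side v)) (onto b∈) in go v v∈ (side v) refl eq
        where
        next : Fin n → Bool → Fin n
        next v true  = β (ν v)
        next v false = α (μ v)
        σ : Fin n → Fin n
        σ v = next v (side v)
        inj : ∀ u v su sv → side u ≡ su → side v ≡ sv → next u su ≡ next v sv → u ≡ v
        inj u v true true p q eq = trans (N.at-α p)
          (trans (cong α (trans (sym (N.mate-β u)) (trans (cong ν eq) (N.mate-β v)))) (sym (N.at-α q)))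
        inj u v true false p q eq = contradiction (sym eq) α≢β
        inj u v false true p q eq = contradiction eq α≢β
        inj u v false false p q eq = trans (M.at-β p)
          (trans (cong β (trans (sym (M.mate-α u)) (trans (cong μ eq) (M.mate-α v)))) (sym (M.at-β q)))
        into : ∀ v s → side v ≡ s → v ∈ W → next v s ∈ W
        into v true  p v∈ = no-exit (ν v) (subst (_∈ W) (N.at-α p) v∈)
        into v false p v∈ = proj₁ (closed v∈)
        onto : W ⊆ map σ W
        onto = ∈-resp-↭ (unique-⊆-≤⇒↭
          (Uniqueₚ.map⁺ (λ {u} {v} → inj u v (side u) (side v) refl refl) uW)
          (λ w∈ → let (v , v∈ , eq) = ∈-map⁻ σ w∈ in subst (_∈ W) (sym eq) (into v (side v) refl v∈))
          (ℕₚ.≤-reflexive (sym (length-map σ W))))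
        go : ∀ v → v ∈ W → ∀ s → side v ≡ s → β e ≡ next v s → α e ∈ W
        go v v∈ true  p eq = subst (_∈ W)
          (trans (N.at-α p) (cong α (trans (sym (N.mate-β v)) (trans (cong ν (sym eq))
            (N.mate-at νe (inj₂ refl)))))) v∈
        go v v∈ false p eq = contradiction (sym eq) α≢β

    -- By connectedness some edge has exactly one end in `W`. If no edge left `W` from its α-end,
    -- `no-exit⇒no-entry` would exclude the other kind as well; so a walk can start at an α-end.
    exit-ear : Through → ∀ {W} → Closed W → Unique W → ∀ {u v} → Star (Link (allFin m)) u v →
               u ∈ W → v ∉ W → OuterEar W
    exit-ear through {W} closed uW path u∈ v∉
      with Finₚ.any? (λ e → (α e ∈V? W) ×-dec ¬? (β e ∈V? W))
    ... | yes (e , a∈ , b∉) = let (N , νe) = through e in Walk.outer-ear N closed νe a∈ b∉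
    ... | no none with star-exit (_∈V? W) path u∈ v∉
    ...   | _ , _ , (e , _ , inj₁ (refl , refl)) , a∈ , b∉ = contradiction (e , a∈ , b∉) none
    ...   | _ , _ , (e , _ , inj₂ (refl , refl)) , b∈ , a∉ =
      let (N , νe) = through e in
      contradiction (no-exit⇒no-entry N closed uW
        (λ f a∈ → decidable-stable (β f ∈V? W) (λ b∉ → none (f , a∈ , b∉))) νe b∈) a∉

    edges-unique : ∀ {a b} (p : Path a b) → Unique (a ∷ b ∷ verts (fs p)) → Unique (edges p)
    edges-unique (edge e _) _ = [] ∷ []
    edges-unique {a} {b} (cons e f eq p)
      ((a≢b ∷ a≢αf ∷ a≢βf ∷ a#) ∷ (b≢αf ∷ b≢βf ∷ b#) ∷ (αf≢βf ∷ αf#) ∷ βf# ∷ u) =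
      Unique-resp-↭ (prep e (↭-sym (shift f (es p) (fs p))))
        ((All.tabulate λ { (here refl) eq → a≢αf (cong α eq) ; (there g∈) refl → a-new (proj₁ (edges-ends p g∈)) })
          ∷ (All.tabulate λ { g∈ refl → βf-new (proj₂ (edges-ends p g∈)) })
          ∷ edges-unique p ((b≢αf ∘ sym ∷ αf#) ∷ b# ∷ u))
      where
      a-new : a ∉ α f ∷ b ∷ verts (fs p)
      a-new (here eq)          = a≢αf eq
      a-new (there (here eq))  = a≢b eq
      a-new (there (there v∈)) = All.lookup a# v∈ refl
      βf-new : β f ∉ α f ∷ b ∷ verts (fs p)
      βf-new (here eq)          = α≢β (sym eq)
      βf-new (there (here eq))  = b≢βf (sym eq)
      βf-new (there (there v∈)) = All.lookup βf# v∈ refl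

    record Extension (W : List (Fin n)) (F : List (Fin m)) : Set where
      field
        {c d}        : Fin n
        ear          : Path c d
        c∈           : c ∈ W
        d∈           : d ∈ W
        unique-verts : Unique (verts (fs ear) ++ W)
        unique-edges : Unique (edges ear ++ F)
        matched      : ∀ {f} → f ∈ fs ear → μ (α f) ≡ f

    outer-extension : ∀ {W F} → Elementary W F → Unique W → Unique F → OuterEar W → Extension W F
    outer-extension {W} {F} H uW uF O = record
      { ear = ear ; c∈ = c∈ ; d∈ = d∈ ; matched = matched
      ; unique-verts = Uniqueₚ.++⁺ unique uW (λ { (v∈p , v∈W) → outside v∈p v∈W })
      ; unique-edges = Uniqueₚ.++⁺
          (edges-unique ear
            (All.tabulate (λ { (here refl) refl → contradiction (trans (sym (source-side ear)) (target-side ear)) λ ()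
                             ; (there v∈) refl → outside v∈ c∈ })
             ∷ All.tabulate (λ { v∈ refl → outside v∈ d∈ }) ∷ unique))
          uF (λ { (e∈p , e∈F) → apart (∈-++⁻ (es ear) e∈p) (Elementary.ends-in H e∈F) })
      }
      where
      open OuterEar O
      apart : ∀ {e} → e ∈ es ear ⊎ e ∈ fs ear → ¬ (α e ∈ W × β e ∈ W)
      apart (inj₁ e∈) (a , b) = [ (λ ¬a → ¬a a) , (λ ¬b → ¬b b) ]′ (leaves e∈)
      apart (inj₂ e∈) (a , _) = outside (proj₁ (verts⁺ e∈)) a

    chord-extension : ∀ {W F} → Unique W → Unique F → ∀ {e} → e ∉ F → α e ∈ W → β e ∈ W → Extension W F
    chord-extension uW uF {e} e∉ a∈ b∈ = record
      { ear = edge e refl ; c∈ = a∈ ; d∈ = b∈ ; unique-verts = uW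
      ; unique-edges = All.tabulate (λ { g∈ refl → e∉ g∈ }) ∷ uF ; matched = λ () }

    -- `ears` lists the ears as they were attached, while `tracked` says that each still contains an
    -- ear removable from the present subgraph. `count` holds because an ear has one more edge than
    -- inner vertices, and the starting edge gives 1 + 1 = 2 + 0.
    record Decomposition (e₀ : Fin m) : Set where
      field
        W       : List (Fin n)
        F       : List (Fin m)
        ears    : List (List (Fin m))
        H       : Elementary W F
        uW      : Unique W
        uF      : Unique F
        closed  : Closed W
        F↭      : F ↭ e₀ ∷ concat ears
        tracked : All (RemovableEar W F) ears
        count   : suc (length F) ≡ length W + length ears

    trivial : ∀ {e} → μ (α e) ≡ e → Decomposition e
    trivial {e} μe = record
      { W = verts [ e ] ; F = [ e ] ; ears = [] ; H = single-edge e
      ; uW = (α≢β ∷ []) ∷ [] ∷ [] ; uF = [] ∷ []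
      ; closed = closed ; F↭ = ↭-refl ; tracked = [] ; count = refl }
      where
      closed : Closed (verts [ e ])
      closed (here refl)         rewrite μe = here refl , there (here refl)
      closed (there (here refl)) rewrite M.mate-at μe (inj₂ refl) = here refl , there (here refl)

    extend : ∀ {e₀} (D : Decomposition e₀) → let open Decomposition D in Extension W F →
             Σ[ D′ ∈ Decomposition e₀ ] length F < length (Decomposition.F D′)
    extend {e₀} D X = record
      { W = verts (fs ear) ++ W ; F = edges ear ++ F ; ears = edges ear ∷ ears
      ; H = add-ear H ear c∈ d∈ ; uW = unique-verts ; uF = unique-edges
      ; closed = closed′
      ; F↭ = ↭-trans (++⁺ˡ (edges ear) F↭) (shift e₀ (edges ear) (concat ears))
      ; tracked = removable-new H ear c∈ d∈ ∷ All.map (λ R → removable-extend R ear c∈ d∈) tracked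
      ; count = count′ } ,
      subst (length F <_) (sym length-F′) (ℕₚ.m≤n+m (suc (length F)) (L + L))
      where
      open Decomposition D
      open Extension X
      L = length (fs ear)
      length-F′ : length (edges ear ++ F) ≡ L + L + suc (length F)
      length-F′ rewrite length-++ (edges ear) {F} | length-++ (es ear) {fs ear} | length-es ear =
        sym (ℕₚ.+-suc (L + L) (length F))
      closed′ : Closed (verts (fs ear) ++ W)
      closed′ v∈ with ∈-++⁻ (verts (fs ear)) v∈
      ... | inj₂ v∈W = let (a , b) = closed v∈W in ∈-++⁺ʳ _ a , ∈-++⁺ʳ _ b
      ... | inj₁ v∈p with verts⁻ (fs ear) v∈p
      ...   | f , f∈ , at rewrite M.mate-at (matched f∈) at =
        let (a , b) = verts⁺ f∈ in ∈-++⁺ˡ a , ∈-++⁺ˡ b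
      count′ : suc (length (edges ear ++ F)) ≡ length (verts (fs ear) ++ W) + suc (length ears)
      count′ rewrite length-F′ | length-++ (verts (fs ear)) {W} | length-verts (fs ear) =
        trans (cong (λ k → suc (L + L + k)) count)
          (ℕ-solve 3 (λ l w t → con 1 :+ (l :+ l :+ (w :+ t)) := (l :+ l) :+ w :+ (con 1 :+ t)) refl
            L (length W) (length ears))

    module _ (through : Through) (linked : ∀ u v → Star (Link (allFin m)) u v) where

      Complete : ∀ {e₀} → Decomposition e₀ → Set
      Complete D = (∀ v → v ∈ Decomposition.W D) × (∀ e → e ∈ Decomposition.F D)

      grow : ∀ k {e₀} (D : Decomposition e₀) → m < k + length (Decomposition.F D) →
             Σ[ D′ ∈ Decomposition e₀ ] Complete D′
      grow zero    D m< = contradiction (unique-length≤ (Decomposition.uF D)) (ℕₚ.<⇒≱ m<)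
      grow (suc k) {e₀} D m< = cases
        (Finₚ.any? (λ v → ¬? (v ∈V? W))) (Finₚ.any? (λ e → ¬? (e ∈E? F)))
        where
        open Decomposition D
        add : Extension W F → Σ[ D′ ∈ Decomposition e₀ ] Complete D′
        add X = let (D′ , lt) = extend D X in
          grow k D′ (ℕₚ.≤-trans m< (ℕₚ.≤-trans (ℕₚ.≤-reflexive (sym (ℕₚ.+-suc k _))) (ℕₚ.+-monoʳ-≤ k lt)))
        cases : Dec (∃[ v ] v ∉ W) → Dec (∃[ e ] e ∉ F) → Σ[ D′ ∈ Decomposition e₀ ] Complete D′
        cases (yes (v , v∉)) _ =
          add (outer-extension H uW uF (exit-ear through closed uW (linked (α e₀) v)
            (proj₁ (Elementary.ends-in H (∈-resp-↭ (↭-sym F↭) (here refl)))) v∉))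
        cases (no allV) dE = cases-E dE
          where
          spans : ∀ v → v ∈ W
          spans v = decidable-stable (v ∈V? W) (λ v∉ → allV (v , v∉))
          cases-E : Dec (∃[ e ] e ∉ F) → Σ[ D′ ∈ Decomposition e₀ ] Complete D′
          -- Once `W` holds every vertex, a missing edge is an ear by itself.
          cases-E (yes (e , e∉)) = add (chord-extension uW uF e∉ (spans (α e)) (spans (β e)))
          cases-E (no allE)      = D , spans , λ e → decidable-stable (e ∈E? F) (λ e∉ → allE (e , e∉))

      decompose : ∀ {e₀} → μ (α e₀) ≡ e₀ → Σ[ D ∈ Decomposition e₀ ] Complete D
      decompose μe = grow (suc m) (trivial μe) (s≤s (ℕₚ.m≤m+n m 1))

-- Degrees and edge deletion in matching covered graphs

module _ (G : Graph) where
  open Graph G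
  private module DV = DecMembership (Fin._≟_ {|V|})

  joins-sym : ∀ {e u v} → Joins G e u v → Joins G e v u
  joins-sym (inj₁ eq) = inj₂ eq
  joins-sym (inj₂ eq) = inj₁ eq

  joins⇒incident : ∀ {e u v} → Joins G e u v → Incident G e u
  joins⇒incident (inj₁ eq) = inj₁ (cong proj₁ eq)
  joins⇒incident (inj₂ eq) = inj₂ (cong proj₂ eq)

  incident⇒joins : ∀ {e v} → Incident G e v → ∃[ u ] Joins G e v u
  incident⇒joins (inj₁ eq) = _ , inj₁ (cong₂ _,_ eq refl)
  incident⇒joins (inj₂ eq) = _ , inj₂ (cong₂ _,_ refl eq)

  incident⇒end : ∀ {e u v x} → Joins G e u v → Incident G e x → x ∈ u ∷ v ∷ []
  incident⇒end (inj₁ eq) (inj₁ p) = here (trans (sym p) (cong proj₁ eq))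
  incident⇒end (inj₁ eq) (inj₂ p) = there (here (trans (sym p) (cong proj₂ eq)))
  incident⇒end (inj₂ eq) (inj₁ p) = there (here (trans (sym p) (cong proj₁ eq)))
  incident⇒end (inj₂ eq) (inj₂ p) = here (trans (sym p) (cong proj₂ eq))

  exit-edge : Connected G → ∀ {W v} → v ∈ W → length W < |V| →
              ∃[ e ] ∃[ x ] ∃[ y ] Joins G e x y × x ∈ W × y ∉ W
  exit-edge conn {W} {v} v∈ W< with Finₚ.any? (λ z → ¬? (z DV.∈? W))
  ... | yes (z , z∉) = let (x , y , (e , j) , x∈ , y∉) = star-exit (DV._∈? W) (conn v z) v∈ z∉ in
    e , x , y , j , x∈ , y∉
  ... | no all = contradiction W<
    (ℕₚ.≤⇒≯ (subst (_≤ length W) (length-tabulate id)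
      (unique-⊆⇒length≤ (Uniqueₚ.allFin⁺ |V|)
        (λ {z} _ → decidable-stable (z DV.∈? W) (λ z∉ → all (z , z∉))))))

  incident-edge : MatchingCovered G → ∀ v → ∃[ e ] Incident G e v
  incident-edge (n≥4 , conn , _) v
    with e , x , y , j , here refl , _ ← exit-edge conn {v ∷ []} (here refl) (ℕₚ.≤-trans (s≤s (s≤s z≤n)) n≥4)
    = e , joins⇒incident j

  -- A vertex with a single edge vu forces vu into every perfect matching,
  -- so no other edge at u is covered.
  degree≥2 : MatchingCovered G → ∀ v → 2 ≤ degree G v
  degree≥2 mc@(n≥4 , conn , cover) v with filter (incident? G v) (allFin |E|) in eq
  ... | _ ∷ _ ∷ _ = s≤s (s≤s z≤n)
  ... | [] = let (e , inc) = incident-edge mc v in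
    contradiction (subst (e ∈_) eq (∈-filter⁺ (incident? G v) (∈-allFin e) inc)) λ ()
  ... | e₁ ∷ [] with e , inc ← incident-edge mc v
      with u , j ← incident⇒joins inc
      with f , x , y , k , x∈ , y∉ ← exit-edge conn {v ∷ u ∷ []} (here refl) (ℕₚ.≤-trans (s≤s (s≤s (s≤s z≤n))) n≥4)
      = contradiction (only-e (at-v x∈)) f≢e
    where
    only : ∀ {g} → Incident G g v → g ≡ e₁
    only {g} i with subst (g ∈_) eq (∈-filter⁺ (incident? G v) (∈-allFin g) i)
    ... | here p = p
    only-e : Incident G f v → f ≡ e
    only-e i = trans (only i) (sym (only inc))
    f≢e : f ≢ e
    f≢e refl = y∉ (incident⇒end j (joins⇒incident (joins-sym k)))
    at-v : x ∈ v ∷ u ∷ [] → Incident G f v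
    at-v (here refl) = joins⇒incident k
    at-v (there (here refl)) =
      let (M , pm , f∈) = cover f
          (g , (g∈ , gv) , _) = pm v
          e∈ = subst (_∈ₛ M) (trans (only gv) (sym (only inc))) g∈
          (_ , _ , uniq) = pm u
      in contradiction (trans (sym (uniq (f∈ , joins⇒incident k))) (uniq (e∈ , joins⇒incident (joins-sym j)))) f≢e

module _ where
  open Graph using (|V|; |E|)

  -- Deletion renumbers the edges. Paths and matchings that avoid `e` are stated here with the edge
  -- names of `G`, so that the renumbering stays inside this proof.
  delete-covered : ∀ G (e : Fin (|E| G)) → |V| G ℕ.≥ 4 →
    (∀ u v → Star (λ x y → ∃[ f ] f ≢ e × Joins G f x y) u v) →
    (∀ f → f ≢ e → Σ[ N ∈ List (Fin (|E| G)) ] e ∉ N × f ∈ N ×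
                   (∀ v → ∃! _≡_ λ g → g ∈ N × Incident G g v)) →
    MatchingCovered (delete G e)
  delete-covered G@(record { |E| = suc m }) e n≥4 conn cover =
    n≥4 ,
    (λ u v → Star.map (λ { (f , f≢e , j) → punchOut (f≢e ∘ sym) ,
                             subst (λ g → Joins G g _ _) (sym (Finₚ.punchIn-punchOut (f≢e ∘ sym))) j }) (conn u v)) ,
    λ i → restrict i (cover (punchIn e i) (Finₚ.punchInᵢ≢i e i))
    where
    open DecMembership (Fin._≟_ {suc m}) using (_∈?_)
    restrict : ∀ i → (Σ[ N ∈ List (Fin (suc m)) ] e ∉ N × punchIn e i ∈ N ×
                        (∀ v → ∃! _≡_ λ g → g ∈ N × Incident G g v)) →
               ∃[ M ] PerfectMatching (delete G e) M × i ∈ₛ M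
    restrict i (N , e∉ , i∈ , pm) = M , perfect , into i∈
      where
      M : Subset m
      M = Vec.tabulate (λ j → does (punchIn e j ∈? N))
      into : ∀ {j} → punchIn e j ∈ N → j ∈ₛ M
      into {j} j∈ = Vecₚ.lookup⇒[]= j M (trans (Vecₚ.lookup∘tabulate _ j) (dec-true (punchIn e j ∈? N) j∈))
      out : ∀ {j} → j ∈ₛ M → punchIn e j ∈ N
      out {j} j∈ with punchIn e j ∈? N | trans (sym (Vecₚ.lookup∘tabulate (λ j → does (punchIn e j ∈? N)) j)) (Vecₚ.[]=⇒lookup j∈)
      ... | yes p | _ = p
      ... | no _  | ()
      perfect : PerfectMatching (delete G e) M
      perfect v with g , (g∈ , inc) , uniq ← pm v =
        punchOut e≢g , (into (subst (_∈ N) (sym back) g∈) , subst (λ h → Incident G h v) (sym back) inc) ,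
        λ { (h∈ , hinc) → Finₚ.punchIn-injective e _ _ (trans back (uniq (out h∈ , hinc))) }
        where
        e≢g : e ≢ g
        e≢g refl = e∉ g∈
        back = Finₚ.punchIn-punchOut e≢g

-- Sums over lists

𝟙 : ∀ {P : Set} → Dec P → ℕ
𝟙 (yes _) = 1
𝟙 (no _)  = 0

∑ : ∀ {A : Set} → List A → (A → ℕ) → ℕ
∑ []       f = 0
∑ (x ∷ xs) f = f x + ∑ xs f

∑-+ : ∀ {A : Set} (xs : List A) f g → ∑ xs (λ x → f x + g x) ≡ ∑ xs f + ∑ xs g
∑-+ []       f g = refl
∑-+ (x ∷ xs) f g rewrite ∑-+ xs f g =
  ℕ-solve 4 (λ a b c d → (a :+ b) :+ (c :+ d) := (a :+ c) :+ (b :+ d)) refl (f x) (g x) (∑ xs f) (∑ xs g)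

∑-≤ : ∀ {A : Set} (xs : List A) {f g} → (∀ x → f x ≤ g x) → ∑ xs f ≤ ∑ xs g
∑-≤ []       le = z≤n
∑-≤ (x ∷ xs) le = ℕₚ.+-mono-≤ (le x) (∑-≤ xs le)

∑-≡ : ∀ {A : Set} (xs : List A) {f g} → (∀ x → f x ≡ g x) → ∑ xs f ≡ ∑ xs g
∑-≡ []       eq = refl
∑-≡ (x ∷ xs) eq = cong₂ _+_ (eq x) (∑-≡ xs eq)

∑-const : ∀ {A : Set} (xs : List A) c → ∑ xs (λ _ → c) ≡ length xs * c
∑-const []       c = refl
∑-const (_ ∷ xs) c = cong (c +_) (∑-const xs c)

∑-allFin : ∀ n c → ∑ (allFin n) (λ _ → c) ≡ c * n
∑-allFin n c = trans (∑-const (allFin n) c)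
  (trans (cong (_* c) (length-tabulate {n = n} (λ i → i))) (ℕₚ.*-comm n c))

∑-comm : ∀ {A B : Set} (xs : List A) (ys : List B) (h : A → B → ℕ) →
         ∑ xs (λ x → ∑ ys (h x)) ≡ ∑ ys (λ y → ∑ xs (λ x → h x y))
∑-comm []       ys h = sym (trans (∑-const ys 0) (ℕₚ.*-zeroʳ (length ys)))
∑-comm (x ∷ xs) ys h = trans (cong (∑ ys (h x) +_) (∑-comm xs ys h)) (sym (∑-+ ys (h x) _))

∑-*ʳ : ∀ {A : Set} (xs : List A) f c → ∑ xs f * c ≡ ∑ xs (λ x → f x * c)
∑-*ʳ []       f c = refl
∑-*ʳ (x ∷ xs) f c = trans (ℕₚ.*-distribʳ-+ c (f x) (∑ xs f)) (cong (f x * c +_) (∑-*ʳ xs f c))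

length-filter≡∑ : ∀ {A : Set} {P : Pred A _} (P? : Decidable P) xs → length (filter P? xs) ≡ ∑ xs (𝟙 ∘ P?)
length-filter≡∑ P? []       = refl
length-filter≡∑ P? (x ∷ xs) with P? x
... | yes _ = cong suc (length-filter≡∑ P? xs)
... | no _  = length-filter≡∑ P? xs

∑-kronecker : ∀ {n} {vs : List (Fin n)} → Unique vs → ∀ x (g : Fin n → ℕ) →
              ∑ vs (λ v → 𝟙 (x Fin.≟ v) * g v) ≤ g x
∑-kronecker []       x g = z≤n
∑-kronecker {vs = v ∷ vs} (v# ∷ u) x g with x Fin.≟ v
... | no _ = ∑-kronecker u x g
... | yes refl = ℕₚ.≤-reflexive (trans (cong₂ _+_ (ℕₚ.+-identityʳ (g x)) (vanish vs v#)) (ℕₚ.+-identityʳ (g x)))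
  where
  vanish : ∀ ws → All (x ≢_) ws → ∑ ws (λ v → 𝟙 (x Fin.≟ v) * g v) ≡ 0
  vanish []       []       = refl
  vanish (w ∷ ws) (ne ∷ a) with x Fin.≟ w
  ... | yes eq = contradiction eq ne
  ... | no _   = vanish ws a

-- A vertex of degree d contributes d (2 + [d = 2]) ≥ 6, and an edge
-- receives at most 5 + [e ∈ E₂] from its ends.
degree-count : ∀ G → let open Graph G in (∀ v → 2 ≤ degree G v) → 6 * |V| ≤ 5 * |E| + |E₂| G
degree-count G deg≥2 = begin
  6 * |V|                                       ≡⟨ ∑-allFin |V| 6 ⟨
  ∑ vs (λ _ → 6)                                ≤⟨ ∑-≤ vs vertex ⟩
  ∑ vs (λ v → degree G v * g v)
    ≡⟨ ∑-≡ vs (λ v → trans (cong (_* g v) (length-filter≡∑ (incident? G v) es)) (∑-*ʳ es _ (g v))) ⟩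
  ∑ vs (λ v → ∑ es (λ e → 𝟙 (incident? G v e) * g v)) ≡⟨ ∑-comm vs es _ ⟩
  ∑ es (λ e → ∑ vs (λ v → 𝟙 (incident? G v e) * g v)) ≤⟨ ∑-≤ es edge-≤ ⟩
  ∑ es (λ e → 5 + 𝟙 (E₂? G e))                  ≡⟨ ∑-+ es _ _ ⟩
  ∑ es (λ _ → 5) + ∑ es (𝟙 ∘ E₂? G)
    ≡⟨ cong₂ _+_ (∑-allFin |E| 5) (sym (length-filter≡∑ (E₂? G) es)) ⟩
  5 * |E| + |E₂| G ∎
  where
  open Graph G
  open ℕₚ.≤-Reasoning
  vs = allFin |V|
  es = allFin |E|
  g : Fin |V| → ℕ
  -- Weight 3 at degree two and 2 elsewhere: degrees two and three both give exactly 6, and an edge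
  -- receives 6 only if both its ends have degree two.
  g v = 2 + 𝟙 (degree G v ℕ.≟ 2)
  vertex : ∀ v → 6 ≤ degree G v * g v
  vertex v with degree G v | deg≥2 v
  ... | suc (suc zero)    | _ = ℕₚ.≤-refl
  ... | suc (suc (suc d)) | _ = ℕₚ.m≤m+n 6 _
  ... | suc zero | s≤s ()
  edge-≤ : ∀ e → ∑ vs (λ v → 𝟙 (incident? G v e) * g v) ≤ 5 + 𝟙 (E₂? G e)
  edge-≤ e = ≤-trans′ (ℕₚ.≤-trans (∑-≤ vs split) (ℕₚ.≤-reflexive (∑-+ vs _ _)))
               (ℕₚ.+-mono-≤ (∑-kronecker uvs p g) (∑-kronecker uvs q g)) final
    where
    ≤-trans′ : ∀ {a b c d} → a ≤ b → b ≤ c → c ≤ d → a ≤ d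
    ≤-trans′ x y z = ℕₚ.≤-trans x (ℕₚ.≤-trans y z)
    p = proj₁ (ends e)
    q = proj₂ (ends e)
    uvs = Uniqueₚ.allFin⁺ |V|
    split : ∀ v → 𝟙 (incident? G v e) * g v ≤ 𝟙 (p Fin.≟ v) * g v + 𝟙 (q Fin.≟ v) * g v
    split v with p Fin.≟ v | q Fin.≟ v
    ... | yes _ | _     = ℕₚ.m≤m+n _ _
    ... | no _  | yes _ = ℕₚ.≤-refl
    ... | no _  | no _  = z≤n
    final : g p + g q ≤ 5 + 𝟙 (E₂? G e)
    final with degree G p ℕ.≟ 2 | degree G q ℕ.≟ 2
    ... | yes _ | yes _ = ℕₚ.≤-refl
    ... | yes _ | no _  = ℕₚ.≤-refl
    ... | no _  | yes _ = ℕₚ.≤-refl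
    ... | no _  | no _  = ℕₚ.m≤m+n 4 1

-- The bound |E₂| ≥ m − n + 2

multiplicity : ∀ {n} → Fin n → List (Fin n) → ℕ
multiplicity v = length ∘ filter (v Fin.≟_)

multiplicity-here : ∀ {n} {v x : Fin n} {xs} → v ≡ x → multiplicity v (x ∷ xs) ≡ suc (multiplicity v xs)
multiplicity-here {v = v} eq = cong length (filter-accept (v Fin.≟_) eq)

multiplicity-skip : ∀ {n} {v x : Fin n} {xs} → v ≢ x → multiplicity v (x ∷ xs) ≡ multiplicity v xs
multiplicity-skip {v = v} ne = cong length (filter-reject (v Fin.≟_) ne)

multiplicity-++ : ∀ {n} (v : Fin n) xs {ys} → multiplicity v (xs ++ ys) ≡ multiplicity v xs + multiplicity v ys
multiplicity-++ v xs {ys} = trans (cong length (filter-++ (v Fin.≟_) xs ys)) (length-++ (filter (v Fin.≟_) xs))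

multiplicity-∉ : ∀ {n} {v : Fin n} {xs} → v ∉ xs → multiplicity v xs ≡ 0
multiplicity-∉ {v = v} v∉ = cong length (filter-none (v Fin.≟_) (All.tabulate λ { x∈ refl → v∉ x∈ }))

multiplicity-unique : ∀ {n} {v : Fin n} {xs} → Unique xs → v ∈ xs → multiplicity v xs ≡ 1
multiplicity-unique {v = v} {x ∷ xs} (x# ∷ u) v∈ with v Fin.≟ x
... | yes refl = cong suc (multiplicity-∉ (λ x∈ → All.lookup x# x∈ refl))
... | no v≢x   = multiplicity-unique u (∈-tail v∈ v≢x)

module Bipartition (G : Graph) (bip : Bipartite G) where
  open Graph G
  side : Fin |V| → Bool
  side = proj₁ bip

  orient : Bool → Fin |V| × Fin |V| → Fin |V| × Fin |V|
  orient true  (u , v) = u , v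
  orient false (u , v) = v , u

  α β : Fin |E| → Fin |V|
  α e = proj₁ (orient (side (proj₁ (ends e))) (ends e))
  β e = proj₂ (orient (side (proj₁ (ends e))) (ends e))

  side-α : ∀ e → side (α e) ≡ true
  side-α e with side (proj₁ (ends e)) in eq | side (proj₂ (ends e)) in eq′ | proj₂ bip e
  ... | true  | _     | _  = eq
  ... | false | true  | _  = eq′
  ... | false | false | ne = contradiction refl ne

  side-β : ∀ e → side (β e) ≡ false
  side-β e with side (proj₁ (ends e)) in eq | side (proj₂ (ends e)) in eq′ | proj₂ bip e
  ... | false | _     | _  = eq
  ... | true  | false | _  = eq′
  ... | true  | true  | ne = contradiction refl ne

  joins-αβ : ∀ e → Joins G e (α e) (β e)
  joins-αβ e with side (proj₁ (ends e))
  ... | true  = inj₁ refl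
  ... | false = inj₂ refl

  incident⇒at : ∀ {e v} → Incident G e v → v ≡ α e ⊎ v ≡ β e
  incident⇒at {e} inc with incident⇒end G (joins-αβ e) inc
  ... | here eq         = inj₁ eq
  ... | there (here eq) = inj₂ eq

  at⇒incident : ∀ {e v} → v ≡ α e ⊎ v ≡ β e → Incident G e v
  at⇒incident {e} (inj₁ refl) = joins⇒incident G (joins-αβ e)
  at⇒incident {e} (inj₂ refl) = joins⇒incident G (joins-sym G (joins-αβ e))

  open Paths α β side side-α side-β
  open Ears α β side side-α side-β
  open Search α β side side-α side-β

  adjacent⇒link : ∀ {u v} → Adjacent G u v → Link (allFin |E|) u v
  adjacent⇒link (e , j) = e , ∈-allFin e ,
    go (incident⇒end G j (at⇒incident (inj₁ refl)))
       (incident⇒end G j (at⇒incident (inj₂ refl)))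
    where
    go : ∀ {u v} → α e ∈ u ∷ v ∷ [] → β e ∈ u ∷ v ∷ [] → (u ≡ α e × v ≡ β e) ⊎ (u ≡ β e × v ≡ α e)
    go (here p)         (there (here q)) = inj₁ (sym p , sym q)
    go (there (here p)) (here q)         = inj₂ (sym q , sym p)
    go (here p)         (here q)         = contradiction (trans p (sym q)) α≢β
    go (there (here p)) (there (here q)) = contradiction (trans p (sym q)) α≢β

  link⇒joins : ∀ {F u v} → Link F u v → ∃[ e ] e ∈ F × Joins G e u v
  link⇒joins (e , e∈ , inj₁ (refl , refl)) = e , e∈ , joins-αβ e
  link⇒joins (e , e∈ , inj₂ (refl , refl)) = e , e∈ , joins-sym G (joins-αβ e)

  mates : ∀ {M} → PerfectMatching G M → Mates
  mates {M} pm = record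
    { mate   = mate
    ; at     = λ v → incident⇒at (proj₂ (proj₁ (proj₂ (pm v))))
    ; mate-α = λ v → mate-in (in-M v) (inj₁ refl)
    ; mate-β = λ v → mate-in (in-M v) (inj₂ refl)
    }
    where
    mate = proj₁ ∘ pm
    in-M : ∀ v → mate v ∈ₛ M
    in-M v = proj₁ (proj₁ (proj₂ (pm v)))
    mate-in : ∀ {e v} → e ∈ₛ M → v ≡ α e ⊎ v ≡ β e → mate v ≡ e
    mate-in {v = v} e∈ at = proj₂ (proj₂ (pm v)) (e∈ , at⇒incident at)

  through : MatchingCovered G → Through
  through (_ , _ , cover) e = let (M , pm , e∈) = cover e in
    mates pm , proj₂ (proj₂ (pm (α e))) (e∈ , at⇒incident (inj₁ refl))

  end∈ : ∀ {ms h v} → h ∈ ms → v ≡ α h ⊎ v ≡ β h → v ∈ verts ms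
  end∈ h∈ (inj₁ refl) = proj₁ (verts⁺ h∈)
  end∈ h∈ (inj₂ refl) = proj₂ (verts⁺ h∈)

  end∉ : ∀ {vs g v} → All (α g ≢_) (β g ∷ vs) → All (β g ≢_) vs → v ≡ α g ⊎ v ≡ β g → v ∉ vs
  end∉ (_ ∷ a#) _  (inj₁ refl) v∈ = All.lookup a# v∈ refl
  end∉ _        b# (inj₂ refl) v∈ = All.lookup b# v∈ refl

  -- Read off the bag of ends, a degree does not depend on the order of the edges and splits as a
  -- sum over an ear and its base.
  degree≡ : ∀ v gs → length (filter (incident? G v) gs) ≡ multiplicity v (verts gs)
  degree≡ v []       = refl
  degree≡ v (g ∷ gs) = go (v Fin.≟ α g) (v Fin.≟ β g)
    where
    covered : v ≡ α g ⊎ v ≡ β g → length (filter (incident? G v) (g ∷ gs)) ≡ suc (multiplicity v (verts gs))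
    covered at = trans (cong length (filter-accept (incident? G v) (at⇒incident at))) (cong suc (degree≡ v gs))
    go : Dec (v ≡ α g) → Dec (v ≡ β g) → length (filter (incident? G v) (g ∷ gs)) ≡ multiplicity v (verts (g ∷ gs))
    go (yes p) _ = trans (covered (inj₁ p))
      (sym (trans (multiplicity-here p) (cong suc (multiplicity-skip (λ q → α≢β (trans (sym p) q))))))
    go (no ¬p) (yes q) = trans (covered (inj₂ q))
      (sym (trans (multiplicity-skip ¬p) (multiplicity-here q)))
    go (no ¬p) (no ¬q) =
      trans (cong length (filter-reject (incident? G v) ([ ¬p , ¬q ]′ ∘ incident⇒at)))
        (trans (degree≡ v gs) (sym (trans (multiplicity-skip ¬p) (multiplicity-skip ¬q))))

  -- Turns the absence of repetitions in `verts ms` into the uniqueness demanded of a perfect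
  -- matching.
  unique-at : ∀ {ms} → Unique (verts ms) → ∀ {g h v} → g ∈ ms → h ∈ ms →
              v ≡ α g ⊎ v ≡ β g → v ≡ α h ⊎ v ≡ β h → g ≡ h
  unique-at u             (here refl) (here refl) _ _ = refl
  unique-at (_ ∷ _ ∷ u)   (there g∈)  (there h∈)  p q = unique-at u g∈ h∈ p q
  unique-at (a# ∷ b# ∷ _) (here refl) (there h∈)  p q = contradiction (end∈ h∈ q) (end∉ a# b# p)
  unique-at (a# ∷ b# ∷ _) (there g∈)  (here refl) p q = contradiction (end∈ g∈ p) (end∉ a# b# q)

  module Extremal (mc : MatchingCovered G) (minimal : Minimal G) where
    -- A removable ear consisting of a single edge would make that edge deletable, against
    -- minimality. In a longer ear both ends of an `fs` edge are inner vertices, each met by one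
    -- edge of `es`, one of `fs` and none of the base.
    removable⇒E₂ : ∀ {W F X} → RemovableEar W F X → Unique W → Unique F → (∀ v → v ∈ W) → (∀ e → e ∈ F) →
                   ∃[ f ] f ∈ X × E₂ G f
    removable⇒E₂ {W} {F} R uW uF allW allF = go ear W↭ F↭ s∈ t∈ ear⊆
      where
      open RemovableEar R using (W₀; F₀; base; ear; s∈; t∈; W↭; F↭; ear⊆)
      open Elementary base
      go : ∀ {s t X} (p : Path s t) → W ↭ verts (fs p) ++ W₀ → F ↭ edges p ++ F₀ → s ∈ W₀ → t ∈ W₀ →
           edges p ⊆ X → ∃[ f ] f ∈ X × E₂ G f
      go (edge e _) w↭ f↭ _ _ _ = contradiction
        (delete-covered G e (proj₁ mc) connected′ cover) (minimal e)
        where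
        e∉ : e ∉ F₀
        e∉ = Uniqueₚ.Unique[x∷xs]⇒x∉xs (Unique-resp-↭ f↭ uF)
        v∈ : ∀ v → v ∈ W₀
        v∈ v = ∈-resp-↭ w↭ (allW v)
        e≢ : ∀ {f} → f ∈ F₀ → f ≢ e
        e≢ f∈ refl = e∉ f∈
        connected′ : ∀ u v → Star (λ x y → ∃[ f ] f ≢ e × Joins G f x y) u v
        connected′ u v = Star.map (λ l → let (f , f∈ , j) = link⇒joins l in f , e≢ f∈ , j) (connected (v∈ u) (v∈ v))
        cover : ∀ f → f ≢ e → Σ[ N ∈ List (Fin |E|) ] e ∉ N × f ∈ N × (∀ v → ∃! _≡_ λ g → g ∈ N × Incident G g v)
        cover f f≢e with ms , sub , ms↭ ← near (v∈ (α f)) (v∈ (β f)) (side-α f) (side-β f) =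
          f ∷ ms ,
          (λ { (here eq) → f≢e (sym eq) ; (there e∈) → e∉ (sub e∈) }) ,
          here refl ,
          λ v → let (g , g∈ , at) = verts⁻ (f ∷ ms) (∈-resp-↭ (↭-sym (↭-trans ms↭ (↭-sym w↭))) (allW v)) in
            g , (g∈ , at⇒incident at) ,
            λ (h∈ , inc) → unique-at (Unique-resp-↭ (↭-sym (↭-trans ms↭ (↭-sym w↭))) uW) g∈ h∈ at (incident⇒at inc)
      go {t = t} p@(cons _ f _ _) w↭ f↭ s∈ t∈ sub =
        f , sub (∈-++⁺ʳ (es p) (here refl)) , ends-degree (proj₁ (ends f)) (inj₁ refl) , ends-degree (proj₂ (ends f)) (inj₂ refl)
        where
        parts = Unique-++⁻ (verts (fs p)) (Unique-resp-↭ w↭ uW)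
        all↭ : allFin |E| ↭ edges p ++ F₀
        all↭ = ↭-trans (unique-⊆⊇⇒↭ (Uniqueₚ.allFin⁺ |E|) uF (λ {e} _ → allF e) (λ {e} _ → ∈-allFin e)) f↭
        ends-degree : ∀ v → Incident G f v → degree G v ≡ 2
        ends-degree v inc = begin
          degree G v                                        ≡⟨ degree≡ v (allFin |E|) ⟩
          multiplicity v (verts (allFin |E|))               ≡⟨ ↭-length (filter-↭ (v Fin.≟_) (verts-↭ all↭)) ⟩
          multiplicity v (verts ((es p ++ fs p) ++ F₀))
            ≡⟨ cong (multiplicity v) (trans (verts-++ (edges p)) (cong (_++ verts F₀) (verts-++ (es p)))) ⟩
          multiplicity v ((verts (es p) ++ verts (fs p)) ++ verts F₀)
            ≡⟨ trans (multiplicity-++ v (verts (es p) ++ verts (fs p)))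
                     (cong₂ _+_ (multiplicity-++ v (verts (es p))) (multiplicity-∉ v∉F₀)) ⟩
          multiplicity v (verts (es p)) + multiplicity v (verts (fs p)) + 0
            ≡⟨ cong₂ (λ x y → x + y + 0) es-mult (multiplicity-unique (proj₁ parts) v∈) ⟩
          2 ∎
          where
          open ≡-Reasoning
          v∈ : v ∈ verts (fs p)
          v∈ = end∈ {ms = fs p} {h = f} (here refl) (incident⇒at inc)
          v∉W₀ : v ∉ W₀
          v∉W₀ = proj₂ (proj₂ parts) v∈
          v∉F₀ : v ∉ verts F₀
          v∉F₀ v∈F with verts⁻ F₀ v∈F
          ... | g , g∈ , inj₁ refl = v∉W₀ (proj₁ (ends-in g∈))
          ... | g , g∈ , inj₂ refl = v∉W₀ (proj₂ (ends-in g∈))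
          es-mult : multiplicity v (verts (es p)) ≡ 1
          es-mult = trans (↭-length (filter-↭ (v Fin.≟_) (verts-path p)))
            (trans (multiplicity-skip {v = v} {xs = t ∷ verts (fs p)} (λ { refl → v∉W₀ s∈ }))
              (trans (multiplicity-skip {v = v} {xs = verts (fs p)} (λ { refl → v∉W₀ t∈ }))
                (multiplicity-unique (proj₁ parts) v∈)))

    E₂-through-ears : ∀ (Xs : List (List (Fin |E|))) → All (λ X → ∃[ f ] f ∈ X × E₂ G f) Xs →
                      length Xs ≤ length (filter (E₂? G) (concat Xs))
    E₂-through-ears []       []                    = z≤n
    E₂-through-ears (X ∷ Xs) ((f , f∈ , f₂) ∷ all) =
      subst (suc (length Xs) ≤_)
        (sym (trans (cong length (filter-++ (E₂? G) X (concat Xs))) (length-++ (filter (E₂? G) X))))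
        (ℕₚ.+-mono-≤ (∈-length (∈-filter⁺ (E₂? G) f∈ f₂)) (E₂-through-ears Xs all))

    record EarCount (e₀ : Fin |E|) : Set where
      field
        ears   : List (List (Fin |E|))
        E₂-ear : All (λ X → ∃[ f ] f ∈ X × E₂ G f) ears
        edges↭ : allFin |E| ↭ e₀ ∷ concat ears
        count  : suc |E| ≡ |V| + length ears

    ear-count : ∀ e₀ → EarCount e₀
    ear-count e₀ with M , μe ← through mc e₀
      with D , allW , allF ← decompose M (through mc) (λ u v → Star.map adjacent⇒link (proj₁ (proj₂ mc) u v)) μe = record
      { ears   = ears
      ; E₂-ear = All.map (λ R → removable⇒E₂ R uW uF allW allF) tracked
      ; edges↭ = ↭-trans F-all F↭
      ; count  = trans (cong suc (trans (sym (length-tabulate {n = |E|} (λ i → i))) (↭-length F-all)))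
                   (trans count (cong (_+ length ears)
                     (trans (↭-length W-all) (length-tabulate {n = |V|} (λ i → i)))))
      }
      where
      open Decomposition D
      F-all : allFin |E| ↭ F
      F-all = unique-⊆⊇⇒↭ (Uniqueₚ.allFin⁺ |E|) uF (λ {e} _ → allF e) (λ {e} _ → ∈-allFin e)
      W-all : W ↭ allFin |V|
      W-all = unique-⊆⊇⇒↭ uW (Uniqueₚ.allFin⁺ |V|) (λ {v} _ → ∈-allFin v) (λ {v} _ → allW v)

    -- A first decomposition, from an arbitrary edge, supplies the `E₂`-edge from which the one that
    -- is counted starts. It has at least one ear: without ears there would be one edge, and `count`
    -- would give two vertices instead of at least four.
    E₂-edge : ∃[ e ] E₂ G e
    E₂-edge with ear-count (proj₁ (incident-edge G mc some-vertex))
      where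
      some-vertex : Fin |V|
      some-vertex = Fin.fromℕ< (ℕₚ.≤-trans (s≤s z≤n) (proj₁ mc))
    ... | record { ears = _ ∷ _ ; E₂-ear = (f , _ , f₂) ∷ _ } = f , f₂
    ... | record { ears = [] ; edges↭ = p ; count = c } = contradiction
      (subst (4 ≤_) (trans (sym (ℕₚ.+-identityʳ |V|))
        (trans (sym c) (cong suc (trans (sym (length-tabulate {n = |E|} (λ i → i))) (↭-length p))))) (proj₁ mc))
      λ { (s≤s (s≤s ())) }

    |E₂|-lower-bound : |E| + 2 ≤ |E₂| G + |V|
    |E₂|-lower-bound with e , e₂ ← E₂-edge with C ← ear-count e = begin
      |E| + 2                       ≡⟨ ℕₚ.+-comm |E| 2 ⟩
      suc (suc |E|)                 ≡⟨ cong suc count ⟩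
      suc (|V| + length ears)       ≡⟨ cong suc (ℕₚ.+-comm |V| _) ⟩
      suc (length ears) + |V|       ≤⟨ ℕₚ.+-monoˡ-≤ |V| (s≤s (E₂-through-ears ears E₂-ear)) ⟩
      suc (length (filter (E₂? G) (concat ears))) + |V| ≡⟨ cong (λ l → length l + |V|) (filter-accept (E₂? G) {xs = concat ears} e₂) ⟨
      length (filter (E₂? G) (e ∷ concat ears)) + |V| ≡⟨ cong (_+ |V|) (↭-length (filter-↭ (E₂? G) edges↭)) ⟨
      |E₂| G + |V|                  ∎
      where
      open EarCount C
      open ℕₚ.≤-Reasoning

-- The containment

ℋ₁⊆ℋ₀ : ∀ G → ℋ₁ G → ℋ₀ G
ℋ₁⊆ℋ₀ G (mbmc@(bip , mc , minimal) , eq) = mbmc , ℕₚ.≤-antisym upper lower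
  where
  open Graph G
  lower : |E| + 2 ≤ |E₂| G + |V|
  lower = Bipartition.Extremal.|E₂|-lower-bound G bip mc minimal
  upper : |E₂| G + |V| ≤ |E| + 2
  -- This direction comes from the degree count and the hypothesis alone. Five copies of the claim
  -- plus one extra `|E₂| G + |V|` make `6 * |E₂| G` appear, which the hypothesis evaluates.
  upper = ℕₚ.*-cancelˡ-≤ 5 (ℕₚ.+-cancelʳ-≤ (|E₂| G + |V|) _ _ (begin
    5 * (|E₂| G + |V|) + (|E₂| G + |V|)
      ≡⟨ ℕ-solve 2 (λ k n → con 5 :* (k :+ n) :+ (k :+ n) := con 6 :* k :+ con 6 :* n) refl
           (|E₂| G) |V| ⟩
    6 * |E₂| G + 6 * |V|                ≤⟨ ℕₚ.+-mono-≤ (ℕₚ.≤-reflexive eq) (degree-count G (degree≥2 G mc)) ⟩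
    (|V| + 10) + (5 * |E| + |E₂| G)
      ≡⟨ ℕ-solve 3 (λ n m k → (n :+ con 10) :+ (con 5 :* m :+ k) := con 5 :* (m :+ con 2) :+ (k :+ n)) refl
           |V| |E| (|E₂| G) ⟩
    5 * (|E| + 2) + (|E₂| G + |V|)      ∎))
    where open ℕₚ.≤-Reasoning

-- An extremal graph that is not n-extremal

-- Uniqueness is spelled out with an explicit quantifier, the form a finite search can decide;
-- `theta-covered` converts it back to `∃!`.
perfect? : ∀ G → Decidable (λ M → ∀ v → ∃[ e ] (e ∈ₛ M × Incident G e v) × (∀ f → f ∈ₛ M × Incident G f v → e ≡ f))
perfect? G M = Finₚ.all? λ v → Finₚ.any? λ e →
  ((e Subsetₚ.∈? M) ×-dec incident? G v e) ×-dec
  Finₚ.all? λ f → ((f Subsetₚ.∈? M) ×-dec incident? G v f) →-dec (e Fin.≟ f)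

-- Four paths of length three between the vertices 0 and 1.
theta : Graph
theta = record
  { |V| = 10
  ; |E| = 12
  ; ends = ends
  ; loopless = from-yes (Finₚ.all? λ e → ¬? (proj₁ (ends e) Fin.≟ proj₂ (ends e)))
  }
  where
  ends : Fin 12 → Fin 10 × Fin 10
  ends = Vec.lookup
    ( (# 0 , # 2) Vec.∷ (# 2 , # 3) Vec.∷ (# 3 , # 1) Vec.∷
      (# 0 , # 4) Vec.∷ (# 4 , # 5) Vec.∷ (# 5 , # 1) Vec.∷
      (# 0 , # 6) Vec.∷ (# 6 , # 7) Vec.∷ (# 7 , # 1) Vec.∷
      (# 0 , # 8) Vec.∷ (# 8 , # 9) Vec.∷ (# 9 , # 1) Vec.∷ Vec.[])

theta-bipartite : Bipartite theta
theta-bipartite = side , from-yes (Finₚ.all? λ e → ¬? (side (proj₁ (Graph.ends theta e)) Bool.≟ side (proj₂ (Graph.ends theta e))))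
  where
  side : Fin 10 → Bool
  side = Vec.lookup (true Vec.∷ false Vec.∷ false Vec.∷ true Vec.∷ false Vec.∷ true Vec.∷
                     false Vec.∷ true Vec.∷ false Vec.∷ true Vec.∷ Vec.[])

theta-connected : Connected theta
theta-connected u v = Star.reverse (λ (e , j) → e , joins-sym theta {e} j) (from-0 u) ◅◅ from-0 v
  where
  along : ∀ e → Adjacent theta (proj₁ (Graph.ends theta e)) (proj₂ (Graph.ends theta e))
  along e = e , inj₁ refl
  from-0 : ∀ v → Star (Adjacent theta) (# 0) v
  from-0 0F = ε
  from-0 1F = along (# 0) ◅ along (# 1) ◅ along (# 2) ◅ ε
  from-0 2F = along (# 0) ◅ ε
  from-0 3F = along (# 0) ◅ along (# 1) ◅ ε
  from-0 4F = along (# 3) ◅ ε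
  from-0 5F = along (# 3) ◅ along (# 4) ◅ ε
  from-0 6F = along (# 6) ◅ ε
  from-0 7F = along (# 6) ◅ along (# 7) ◅ ε
  from-0 8F = along (# 9) ◅ ε
  from-0 9F = along (# 9) ◅ along (# 10) ◅ ε

-- The perfect matching using the outer edges of the i-th path.
theta-matching : Fin 4 → Subset 12
theta-matching i = Vec.concat (Vec.tabulate λ j → block (i Fin.≟ j))
  where
  block : ∀ {P : Set} → Dec P → Subset 3
  block (yes _) = true Vec.∷ false Vec.∷ true Vec.∷ Vec.[]
  block (no _)  = false Vec.∷ true Vec.∷ false Vec.∷ Vec.[]

theta-covered : MatchingCovered theta
theta-covered = s≤s (s≤s (s≤s (s≤s z≤n))) , theta-connected , λ e →
  let (i , e∈) = in-some e in theta-matching i , perfect i , e∈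
  where
  in-some : ∀ e → ∃[ i ] e ∈ₛ theta-matching i
  in-some = from-yes (Finₚ.all? λ e → Finₚ.any? λ i → e Subsetₚ.∈? theta-matching i)
  checked = from-yes (Finₚ.all? λ i → perfect? theta (theta-matching i))
  perfect : ∀ i → PerfectMatching theta (theta-matching i)
  perfect i v = let (e , at , uniq) = checked i v in e , at , λ {f} → uniq f

-- Every edge has an inner vertex of one of the paths as an end. That vertex has degree two, and
-- deleting the edge leaves it with degree one.
theta-minimal : Minimal theta
theta-minimal e mc =
  let (v , deg<2) = from-yes (Finₚ.all? λ e → Finₚ.any? λ v → degree (delete theta e) v ℕ.<? 2) e in
  ℕₚ.<⇒≱ deg<2 (degree≥2 (delete theta e) mc v)

theta∈ℋ₀ : ℋ₀ theta
-- The four middle edges form `E₂`, and 4 + 10 = 12 + 2.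
theta∈ℋ₀ = (theta-bipartite , theta-covered , theta-minimal) , refl

-- Only the number of vertices has to be carried across the isomorphism. Three paths in place of
-- four would not separate the classes: there n + 10 = 18 and `|E₂|` is 3, so equality holds.
theta≇ℋ₁ : ∀ H → theta ≅ H → ¬ ℋ₁ H
theta≇ℋ₁ H iso (_ , eq) = 6∤20 (|E₂| H) (trans eq (cong (_+ 10) (sym n≡10)))
  where
  open _≅_ iso
  n≡10 : 10 ≡ Graph.|V| H
  n≡10 = ℕₚ.≤-antisym
    (Finₚ.injective⇒≤ (Injection.injective (↔⇒↣ vertices)))
    (Finₚ.injective⇒≤ (Injection.injective (↔⇒↣ (↔-sym vertices))))
  6∤20 : ∀ k → 6 * k ≢ 20
  6∤20 k eq = from-no (6 ∣? 20) (divides k (trans (sym eq) (ℕₚ.*-comm 6 k)))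

corollary7p11 : ℋ₁ ⊊ ℋ₀
corollary7p11 = ℋ₁⊆ℋ₀ , theta , theta∈ℋ₀ , theta≇ℋ₁
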